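{- For any fixed integer $d\ge 2$, the problem $d$-DISTANCE $k$-PERFECT CODE restricted to unit 2-track interval graphs is W[1]-hard with parameter $k$.
   Context: A perfect code in a graph is a set of vertices that includes exactly one vertex from the closed neighborhood $N[u]$ (that is, $u$ together with its neighbors) of each vertex $u$. The $d$th power of a graph $H$ has the same vertex set, with two distinct vertices adjacent iff their distance in $H$ is at most $d$. $d$-DISTANCE $k$-PERFECT CODE: given a graph $H$ and an integer $k$, decide whether the $d$th power of $H$ has a perfect code of size exactly $k$; that is, whether there is a set of exactly $k$ vertices such that each vertex of $H$ is within distance $d$ of exactly one vertex of the set. The intersection graph of a family of sets has one vertex per member, two different members being adjacent iff they intersect; the family is a representation of the graph. A 2-track interval is the union of two intervals on two disjoint parallel lines (tracks), one interval on each track. A unit 2-track interval graph is the intersection graph of a family of 2-track intervals in which all intervals have unit length. Such a representation of $H$ is given as part of the input. A parameterized problem is W[1]-hard if every problem in W[1] has an FPT reduction to it; equivalently, if $k$-CLIQUE in general graphs (parameter $k$) has an FPT reduction to it. An FPT reduction maps an instance $(x,k)$ to an equivalent instance $(x',k')$ in time $g(k)\cdot|x|^{O(1)}$ with $k'\le h(k)$, for computable functions $g,h$. -}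

module Defs where

open import Data.Bool.Base using (Bool; true; false; if_then_else_)
open import Data.Fin.Base using (Fin)
open import Data.Fin.Subset using (Subset; ∣_∣) renaming (_∈_ to _∈ˢ_)
open import Data.Integer.Base as ℤ using (ℤ; +_; -[1+_])
open import Data.List.Base
  using (List; []; _∷_; _++_; [_]; map; concatMap; allFin; drop; head; length;
         cartesianProductWith)
open import Data.Maybe.Base using (fromMaybe)
open import Data.Nat.Base using (ℕ; suc; _+_; _*_; _∸_; _^_; _≤_)
open import Data.Nat.ListAction using (sum)
open import Data.Nat.Properties using (_≟_)
open import Data.Nat.Logarithm using (⌊log₂_⌋)
open import Data.Product using (∃; ∃!; ∃-syntax; _×_; _,_)
open import Data.Rational.Unnormalised.Base as ℚ using (ℚᵘ; 1ℚᵘ)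
open import Data.Sum.Base using (_⊎_)
open import Function.Bundles using (_⇔_)
open import Level using (0ℓ)
open import Relation.Binary.Core using (Rel)
open import Relation.Binary.Definitions using (Symmetric; Irreflexive; Decidable)
open import Relation.Binary.PropositionalEquality using (_≡_; _≢_; refl; sym)
open import Relation.Nullary using (does)
open import Relation.Unary using (Pred; _≬_)

-- A word is a list of naturals written in binary; its size is the total number
-- of binary digits.
Word : Set
Word = List ℕ

size : Word → ℕ
size w = sum (map (λ m → suc ⌊log₂ m ⌋) w)

-- Programs are while programs for a RAM with read-only, randomly accessible
-- input and append-only output. There is deliberately no multiplication: with
-- addition and monus only, each step lengthens the longest number in memory by
-- at most a constant depending on the program, so the uniform cost below is
-- polynomially related to Turing machine time (Cook and Reckhow).
data Expr : Set where
  lit     : ℕ → Expr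
  mem     : Expr → Expr            -- indirect addressing
  input   : Expr → Expr            -- 0 beyond the end of the input
  inputLength : Expr
  _⊕_ _⊖_ : Expr → Expr → Expr     -- _⊖_ is truncated

infixl 6 _⊕_ _⊖_
infix  4 mem[_]≔_
infixr 3 _⨾_

data Cmd : Set where
  skip           : Cmd
  mem[_]≔_       : Expr → Expr → Cmd
  emit           : Expr → Cmd
  _⨾_            : Cmd → Cmd → Cmd
  ifNonZero_then_else_ : Expr → Cmd → Cmd → Cmd
  whileNonZero_loop_   : Expr → Cmd → Cmd

Memory : Set
Memory = ℕ → ℕ

_[_↦_] : Memory → ℕ → ℕ → Memory
(μ [ a ↦ v ]) b = if does (b ≟ a) then v else μ b

record State : Set where
  constructor ⟨_,_⟩
  field
    memory : Memory
    output : Word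
open State public

eval : Word → Memory → Expr → ℕ
eval x μ (lit m)     = m
eval x μ (mem e)     = μ (eval x μ e)
eval x μ (input e)   = fromMaybe 0 (head (drop (eval x μ e) x))
eval x μ inputLength = length x
eval x μ (e ⊕ f)     = eval x μ e + eval x μ f
eval x μ (e ⊖ f)     = eval x μ e ∸ eval x μ f

-- x ⊢ c , s ⇓ s′ in-steps t: on input x, command c started in state s halts
-- in state s′ after t steps. Evaluating the expressions of a command is part of
-- its one step, as their sizes are fixed by the program.
infix 4 _⊢_,_⇓_in-steps_

data _⊢_,_⇓_in-steps_ (x : Word) : Cmd → State → State → ℕ → Set where
  skip : ∀ {s} → x ⊢ skip , s ⇓ s in-steps 1

  assign : ∀ {μ w d e} →
    x ⊢ mem[ d ]≔ e , ⟨ μ , w ⟩ ⇓ ⟨ μ [ eval x μ d ↦ eval x μ e ] , w ⟩ in-steps 1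

  emit : ∀ {μ w e} →
    x ⊢ emit e , ⟨ μ , w ⟩ ⇓ ⟨ μ , w ++ [ eval x μ e ] ⟩ in-steps 1

  seq : ∀ {c c′ s s′ s″ t t′} →
    x ⊢ c , s ⇓ s′ in-steps t →
    x ⊢ c′ , s′ ⇓ s″ in-steps t′ →
    x ⊢ c ⨾ c′ , s ⇓ s″ in-steps (t + t′)

  if-then : ∀ {e c c′ s s′ t} →
    eval x (memory s) e ≢ 0 →
    x ⊢ c , s ⇓ s′ in-steps t →
    x ⊢ ifNonZero e then c else c′ , s ⇓ s′ in-steps (suc t)

  if-else : ∀ {e c c′ s s′ t} →
    eval x (memory s) e ≡ 0 →
    x ⊢ c′ , s ⇓ s′ in-steps t →
    x ⊢ ifNonZero e then c else c′ , s ⇓ s′ in-steps (suc t)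

  while-stop : ∀ {e c s} →
    eval x (memory s) e ≡ 0 →
    x ⊢ whileNonZero e loop c , s ⇓ s in-steps 1

  while-step : ∀ {e c s s′ s″ t t′} →
    eval x (memory s) e ≢ 0 →
    x ⊢ c , s ⇓ s′ in-steps t →
    x ⊢ whileNonZero e loop c , s′ ⇓ s″ in-steps t′ →
    x ⊢ whileNonZero e loop c , s ⇓ s″ in-steps (suc (t + t′))

initial : State
initial = ⟨ (λ _ → 0) , [] ⟩

_maps_to_in-steps_ : Cmd → Word → Word → ℕ → Set
p maps x to y in-steps t = ∃[ s ] (x ⊢ p , initial ⇓ s in-steps t) × output s ≡ y

Computable : (ℕ → ℕ) → Set
Computable f = ∃[ p ] (∀ m → ∃[ t ] p maps [ m ] to [ f m ] in-steps t)

record ParameterizedProblem : Set₂ where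
  field
    Instance  : Set₁
    encode    : Instance → Word
    parameter : Instance → ℕ
    Yes       : Instance → Set

record FPTReduction (P Q : ParameterizedProblem) : Set₁ where
  private
    module P = ParameterizedProblem P
    module Q = ParameterizedProblem Q
  field
    reduce       : P.Instance → Q.Instance
    correct      : ∀ i → P.Yes i ⇔ Q.Yes (reduce i)
    program      : Cmd
    g h          : ℕ → ℕ
    g-computable : Computable g
    h-computable : Computable h
    exponent     : ℕ
    runs-in-time : ∀ i → ∃[ t ]
      program maps P.encode i to Q.encode (reduce i) in-steps t ×
      t ≤ g (P.parameter i) * size (P.encode i) ^ exponent
    parameter-bound : ∀ i → Q.parameter (reduce i) ≤ h (P.parameter i)

record Graph (n : ℕ) : Set₁ where
  infix 4 _~_
  field
    _~_      : Rel (Fin n) 0ℓ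
    ~-sym    : Symmetric _~_
    ~-irrefl : Irreflexive _≡_ _~_

module _ {n : ℕ} (G : Graph n) where
  open Graph G

  data Walk : ℕ → Fin n → Fin n → Set where
    []  : ∀ {u} → Walk 0 u u
    _∷_ : ∀ {l u v w} → u ~ v → Walk l v w → Walk (suc l) u w

  DistanceAtMost : ℕ → Fin n → Fin n → Set
  DistanceAtMost d u v = ∃[ l ] l ≤ d × Walk l u v

  IsClique : Subset n → Set
  IsClique S = ∀ u v → u ∈ˢ S → v ∈ˢ S → u ≢ v → u ~ v

  ClosedNeighbourhood : Fin n → Pred (Fin n) 0ℓ
  ClosedNeighbourhood u v = v ≡ u ⊎ u ~ v

  IsPerfectCode : Subset n → Set
  IsPerfectCode S = ∀ u → ∃! _≡_ (λ v → v ∈ˢ S × ClosedNeighbourhood u v)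

  IsIntersectionGraphOf : {A : Set} → (Fin n → Pred A 0ℓ) → Set
  IsIntersectionGraphOf F = ∀ u v → (u ~ v) ⇔ (u ≢ v × F u ≬ F v)

module _ {n : ℕ} (G : Graph n) where
  open Graph G

  private
    snoc : ∀ {l u v w} → Walk G l u v → v ~ w → Walk G (suc l) u w
    snoc []      b = b ∷ []
    snoc (a ∷ p) b = a ∷ snoc p b

    reverse : ∀ {l u v} → Walk G l u v → Walk G l v u
    reverse []      = []
    reverse (a ∷ p) = snoc (reverse p) (~-sym a)

  power : ℕ → Graph n
  power d = record
    { _~_      = λ u v → u ≢ v × DistanceAtMost G d u v
    ; ~-sym    = λ (u≢v , l , l≤d , p) → (λ v≡u → u≢v (sym v≡u)) , l , l≤d , reverse p
    ; ~-irrefl = λ u≡v (u≢v , _) → u≢v u≡v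
    }

data Track : Set where
  track₁ track₂ : Track

-- A point of the two disjoint lines. Rational lines lose nothing: a finite family
-- of closed unit intervals on the real line can be moved to rational endpoints
-- without changing which of them meet, and two closed intervals with rational
-- endpoints that meet have a rational point in common.
Point : Set
Point = Track × ℚᵘ

-- Given by the left endpoints of its two closed unit intervals.
UnitTwoTrackInterval : Set
UnitTwoTrackInterval = Track → ℚᵘ

points : UnitTwoTrackInterval → Pred Point 0ℓ
points I (τ , q) = I τ ℚ.≤ q × q ℚ.≤ I τ ℚ.+ 1ℚᵘ

encodeBool : Bool → ℕ
encodeBool false = 0
encodeBool true  = 1

encodeℤ : ℤ → Word
encodeℤ (+ m)    = 0 ∷ m ∷ []
encodeℤ -[1+ m ] = 1 ∷ suc m ∷ []

encodeℚ : ℚᵘ → Word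
encodeℚ q = encodeℤ (ℚ.↥ q) ++ [ ℚ.↧ₙ q ]

encodeInterval : UnitTwoTrackInterval → Word
encodeInterval I = encodeℚ (I track₁) ++ encodeℚ (I track₂)

encodeMatrix : ∀ {n} {_~_ : Rel (Fin n) 0ℓ} → Decidable _~_ → Word
encodeMatrix {n} _~?_ =
  cartesianProductWith (λ u v → encodeBool (does (u ~? v))) (allFin n) (allFin n)

record CliqueInstance : Set₁ where
  field
    {order} : ℕ
    graph   : Graph order
    _~?_    : Decidable (Graph._~_ graph)
    k       : ℕ

Clique : ParameterizedProblem
Clique = record
  { Instance  = CliqueInstance
  ; encode    = λ i → let open CliqueInstance i in order ∷ k ∷ encodeMatrix _~?_
  ; parameter = CliqueInstance.k
  ; Yes       = λ i → let open CliqueInstance i in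
      ∃[ S ] IsClique graph S × ∣ S ∣ ≡ k
  }

-- k-Clique is W[1]-complete, so a reduction from it yields one from every problem
-- in W[1].
W[1]-Hard : ParameterizedProblem → Set₁
W[1]-Hard Q = FPTReduction Clique Q

-- A graph together with a representation by unit 2-track intervals, both of
-- which are part of the encoded input.
record UnitTwoTrackInstance : Set₁ where
  field
    {order}    : ℕ
    graph      : Graph order
    _~?_       : Decidable (Graph._~_ graph)
    family     : Fin order → UnitTwoTrackInterval
    represents : IsIntersectionGraphOf graph (λ u → points (family u))
    k          : ℕ

DistancePerfectCodeOnUnitTwoTrackGraphs : ℕ → ParameterizedProblem
DistancePerfectCodeOnUnitTwoTrackGraphs d = record
  { Instance  = UnitTwoTrackInstance
  ; encode    = λ i → let open UnitTwoTrackInstance i in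
      order ∷ k ∷ encodeMatrix _~?_ ++
      concatMap (λ u → encodeInterval (family u)) (allFin order)
  ; parameter = UnitTwoTrackInstance.k
  ; Yes       = λ i → let open UnitTwoTrackInstance i in
      ∃[ S ] IsPerfectCode (power graph d) S × ∣ S ∣ ≡ k
  }

{-# OPTIONS --safe #-}

-- A k-clique is a labelling of a k × k grid: cell (i , j) carries a pair (u , v)
-- with u ~ v if i ≠ j and u = v if i = j, the first components agree along each row
-- and the second ones along each column. All candidate pairs of a cell are mutually
-- adjacent vertices; two pendant paths of length d, one on each side, can only be
-- served simultaneously by a candidate, so a perfect code of size k² picks exactly
-- one candidate per cell. From each candidate a path leads to four ports at distance
-- d − 1. The port towards the next cell reaches the test vertices t ≤ u at distance
-- d, that of the next cell, with value u′, reaches those with u′ < t; every test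
-- vertex t < n is covered exactly once iff u = u′. On the tracks the values and t
-- become offsets of less than one unit, so that intervals in blocks one unit apart
-- meet iff t ≤ u, respectively u′ < t.

module Submission where

open import Defs
open import Data.Bool.Base using (T; true; false; not; _∧_; _∨_)
open import Data.Empty using (⊥; ⊥-elim)
open import Data.Fin.Base using (Fin; zero; suc; toℕ; fromℕ<; combine; remQuot)
import Data.Fin.Properties as Fin
open import Data.Fin.Subset using (Subset; ∣_∣) renaming (_∈_ to _∈ˢ_)
open import Data.Integer.Base as ℤ using (+_)
import Data.Integer.Properties as ℤ
open import Data.List.Base
  using (List; []; _∷_; _++_; [_]; length; head; drop; map; concatMap; tabulate; allFin; lookup;
         replicate; cartesianProductWith)
open import Data.List.Membership.Propositional using (_∈_)
open import Data.List.Membership.Propositional.Properties using (∈-++⁺ˡ; ∈-++⁺ʳ; ∈-++⁻; ∈-lookup)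
open import Data.List.Properties
  using (++-assoc; ++-identityʳ; length-++; length-map; length-tabulate; concatMap-++; map-replicate)
open import Data.List.Relation.Unary.All using (All; []; _∷_)
open import Data.List.Relation.Unary.Any as Any using (here; there)
open import Data.List.Relation.Unary.Any.Properties using (lookup-index)
open import Data.Maybe.Base using (fromMaybe)
open import Data.Nat.Base hiding (∣_-_∣)
open import Data.Nat.Logarithm using (⌊log₂_⌋)
open import Data.Nat.Properties
open import Data.Nat.Tactic.RingSolver using (solve-∀)
open import Data.Product using (Σ-syntax; ∃-syntax; _×_; _,_; proj₁; proj₂)
open import Data.Rational.Unnormalised.Base as ℚ using (mkℚᵘ; 1ℚᵘ)
import Data.Rational.Unnormalised.Properties as ℚ
open import Data.Sum.Base using (_⊎_; inj₁; inj₂)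
open import Data.Unit.Base using (⊤; tt)
open import Data.Vec.Base using ([]; _∷_; here; there)
import Data.Vec.Base as Vec
import Data.Vec.Properties as Vec
open import Function.Base using (_∘_; id)
open import Function.Bundles using (_⇔_; mk⇔; Equivalence)
open import Function.Definitions using (Injective)
open import Relation.Binary.Definitions using (Decidable; tri<; tri≈; tri>)
open import Relation.Binary.PropositionalEquality hiding ([_])
open import Relation.Nullary using (Dec; yes; no; does)
open import Relation.Nullary.Decidable
  using (dec-true; dec-false; decidable-stable; ¬?; _×-dec_; _⊎-dec_)
open import Relation.Unary using (_≬_)

-- Loop programs on the random access machine

-- A vertex has only two intervals. A candidate spends one on its cell and one on its own chain, so
-- the checks have to be attached through separate vertices, the ports; these need `d - 1 ≥ 1`,
-- hence `d = suc (suc e)`. The candidates of a cell being mutually adjacent, the chains of the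
-- others are entered as well, but one step late: their ports are reached at distance at most `d`,
-- hence covered, while the tests behind them are not. So each candidate covers its entire cell, and
-- only tests tell candidates apart. The size forces one candidate per cell because no vertex is
-- within `d` of the first path ends of two cells: these ends use up all `k * k` members, and one of
-- the same members must serve the other end. The program cannot emit while it generates: the output
-- starts with the number of vertices, known only after all candidate pairs have been filtered, and
-- the matrix compares all pairs of vertices. One stage therefore stores the starting points in
-- memory and a second one reads them back.

nth : Word → ℕ → ℕ
nth w a = fromMaybe 0 (head (drop a w))

-- Recursion peels off the last index, so that iteration `i` of a loop appends exactly `f i` to what
-- the first `i` iterations wrote.
collect : {A : Set} → ℕ → (ℕ → List A) → List A
collect zero    f = []
collect (suc n) f = collect n f ++ f n

keep : {A : Set} → ℕ → List A → List A
keep zero    w = []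
keep (suc _) w = w

horner : ℕ → ℕ → List ℕ → ℕ
horner b acc []       = acc
horner b acc (c ∷ cs) = horner b (acc * b + c) cs

data Sink : Set where
  array tape : Sink

infixl 6 _⊕_ _⊖_
infixr 3 _⊙_

-- Loops and lets bind the next variable, so variables are numbered by de Bruijn
-- levels. What goes to the array can be read back only when writing to the tape.
data Term : Sink → ℕ → Set where
  var     : ∀ {s m} l {_ : T (l <ᵇ m)} → Term s m
  lit     : ∀ {s m} → ℕ → Term s m
  input   : ∀ {s m} → Term s m → Term s m
  stored  : ∀ {m} → Term tape m → Term tape m
  _⊕_ _⊖_ : ∀ {s m} → Term s m → Term s m → Term s m

-- Variable `m` lives in register `3 + m` and the array begins at 16, hence the bound 13 on binders;
-- `put` may have all 13 variables in scope, hence 14. `letHorner` is the only source of products.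
data Gen (s : Sink) : ℕ → Set where
  put       : ∀ {m} {_ : T (m <ᵇ 14)} → Term s m → Gen s m
  _⊙_       : ∀ {m} → Gen s m → Gen s m → Gen s m
  when      : ∀ {m} → Term s m → Gen s m → Gen s m
  for       : ∀ {m} {_ : T (m <ᵇ 13)} → Term s m → Gen s (suc m) → Gen s m
  letHorner : ∀ {m} {_ : T (m <ᵇ 13)} → Term s m → List (Term s m) → Gen s (suc m) → Gen s m

-- Memory layout: 0 counts the numbers written to the array, 1 and 2 are scratch
-- registers, 3 to 15 hold the variables, and the array starts at 16.
expr : ∀ {s m} → Term s m → Expr
expr (var l)    = mem (lit (3 + l))
expr (lit c)    = lit c
expr (input t)  = input (expr t)
expr (stored t) = mem (lit 16 ⊕ expr t)
expr (t ⊕ u)    = expr t ⊕ expr u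
expr (t ⊖ u)    = expr t ⊖ expr u

-- The multiplier in register 2 is the base of a Horner evaluation and register 1 the old
-- accumulator: the time is linear in the base, although the accumulator may be as large as a power
-- of it.
addMultiple : ℕ → Cmd
addMultiple m =
  whileNonZero mem (lit 2) loop
    (mem[ lit (3 + m) ]≔ mem (lit (3 + m)) ⊕ mem (lit 1) ⨾ mem[ lit 2 ]≔ mem (lit 2) ⊖ lit 1)

digits : ∀ {s} m → Term s m → List (Term s m) → Cmd
digits m b []       = skip
digits m b (t ∷ ts) =
  (mem[ lit 1 ]≔ mem (lit (3 + m)) ⨾ mem[ lit 2 ]≔ expr b ⨾ mem[ lit (3 + m) ]≔ expr t ⨾ addMultiple m)
  ⨾ digits m b ts

append : ∀ s {m} → Term s m → Cmd
append array t = mem[ lit 16 ⊕ mem (lit 0) ]≔ expr t ⨾ mem[ lit 0 ]≔ mem (lit 0) ⊕ lit 1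
append tape  t = emit (expr t)

compile : ∀ {s m} → Gen s m → Cmd
compile {s} (put t)     = append s t
compile (g ⊙ h)         = compile g ⨾ compile h
compile (when t g)      = ifNonZero expr t then compile g else skip
compile {m = m} (for t g) =
  mem[ lit (3 + m) ]≔ lit 0 ⨾
  whileNonZero expr t ⊖ mem (lit (3 + m)) loop
    (compile g ⨾ mem[ lit (3 + m) ]≔ mem (lit (3 + m)) ⊕ lit 1)
compile {m = m} (letHorner b ts g) = mem[ lit (3 + m) ]≔ lit 0 ⨾ digits m b ts ⨾ compile g

update-same : ∀ (μ : Memory) a v → (μ [ a ↦ v ]) a ≡ v
update-same μ a v rewrite dec-true (a ≟ a) refl = refl

update-other : ∀ (μ : Memory) {a b} v → b ≢ a → (μ [ a ↦ v ]) b ≡ μ b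
update-other μ {a} {b} v b≢a rewrite dec-false (b ≟ a) b≢a = refl

nth-++-length : ∀ w v → nth (w ++ [ v ]) (length w) ≡ v
nth-++-length []      v = refl
nth-++-length (_ ∷ w) v = nth-++-length w v

nth-++-other : ∀ w v {a} → a ≢ length w → nth (w ++ [ v ]) a ≡ nth w a
nth-++-other []      v {zero}  a≢ = ⊥-elim (a≢ refl)
nth-++-other []      v {suc zero}    a≢ = refl
nth-++-other []      v {suc (suc a)} a≢ = refl
nth-++-other (_ ∷ w) v {zero}  a≢ = refl
nth-++-other (_ ∷ w) v {suc a} a≢ = nth-++-other w v (a≢ ∘ cong suc)

nth-[] : ∀ a → nth [] a ≡ 0
nth-[] zero    = refl
nth-[] (suc a) = refl

-- Step counts of loop programs and their polynomial bounds

cost : ∀ {s m} → ℕ → Gen s m → ℕ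
cost B (put t)            = 2
cost B (g ⊙ h)            = cost B g + cost B h
cost B (when t g)         = 2 + cost B g
cost B (for t g)          = 2 + B * (2 + cost B g)
cost B (letHorner b ts g) = 2 + length ts * (4 + B * 3) + cost B g

coefficient degree : ∀ {s m} → Gen s m → ℕ
coefficient (put t)            = 2
coefficient (g ⊙ h)            = coefficient g + coefficient h
coefficient (when t g)         = 2 + coefficient g
coefficient (for t g)          = 4 + coefficient g
coefficient (letHorner b ts g) = 2 + length ts * 4 + coefficient g
degree (put t)            = 0
degree (g ⊙ h)            = degree g ⊔ degree h
degree (when t g)         = degree g
degree (for t g)          = suc (degree g)
degree (letHorner b ts g) = suc (degree g)

1≤^ : ∀ B e → 1 ≤ suc B ^ e
1≤^ B e = m^n>0 (suc B) e

cost≤ : ∀ {s m} B (g : Gen s m) → cost B g ≤ coefficient g * suc B ^ degree g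
cost≤ B (put t) = ≤-refl
cost≤ B (g ⊙ h) = begin
  cost B g + cost B h
    ≤⟨ +-mono-≤ (cost≤ B g) (cost≤ B h) ⟩
  coefficient g * suc B ^ degree g + coefficient h * suc B ^ degree h
    ≤⟨ +-mono-≤ (*-monoʳ-≤ (coefficient g) (^-monoʳ-≤ (suc B) (m≤m⊔n (degree g) (degree h))))
         (*-monoʳ-≤ (coefficient h) (^-monoʳ-≤ (suc B) (m≤n⊔m (degree g) (degree h)))) ⟩
  coefficient g * P + coefficient h * P
    ≡⟨ *-distribʳ-+ P (coefficient g) (coefficient h) ⟨
  (coefficient g + coefficient h) * P ∎
  where
  open ≤-Reasoning
  P = suc B ^ (degree g ⊔ degree h)
cost≤ B (when t g) = begin
  2 + cost B g  ≤⟨ +-mono-≤ (*-monoʳ-≤ 2 (1≤^ B (degree g))) (cost≤ B g) ⟩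
  2 * P + coefficient g * P  ≡⟨ *-distribʳ-+ P 2 (coefficient g) ⟨
  (2 + coefficient g) * P  ∎
  where
  open ≤-Reasoning
  P = suc B ^ degree g
cost≤ B (for t g) = begin
  2 + B * (2 + cost B g)
    ≤⟨ +-mono-≤ (*-monoʳ-≤ 2 (1≤^ B (suc (degree g))))
         (*-mono-≤ (n≤1+n B) (+-mono-≤ (*-monoʳ-≤ 2 (1≤^ B (degree g))) (cost≤ B g))) ⟩
  2 * (suc B * P) + suc B * (2 * P + coefficient g * P)
    ≡⟨ lemma (suc B) P (coefficient g) ⟩
  (4 + coefficient g) * (suc B * P) ∎
  where
  open ≤-Reasoning
  P = suc B ^ degree g
  lemma : ∀ b p c → 2 * (b * p) + b * (2 * p + c * p) ≡ (4 + c) * (b * p)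
  lemma = solve-∀
cost≤ B (letHorner b ts g) = begin
  2 + length ts * (4 + B * 3) + cost B g
    ≤⟨ +-mono-≤ (+-mono-≤ (*-monoʳ-≤ 2 (1≤^ B (suc (degree g)))) (*-monoʳ-≤ (length ts) four)) five ⟩
  2 * (suc B * P) + length ts * (4 * (suc B * P)) + coefficient g * (suc B * P)
    ≡⟨ lemma (suc B * P) (length ts) (coefficient g) ⟩
  (2 + length ts * 4 + coefficient g) * (suc B * P) ∎
  where
  open ≤-Reasoning
  P = suc B ^ degree g
  lemma : ∀ p l c → 2 * p + l * (4 * p) + c * p ≡ (2 + l * 4 + c) * p
  lemma = solve-∀
  four : 4 + B * 3 ≤ 4 * (suc B * P)
  four = begin
    4 + B * 3         ≤⟨ +-monoʳ-≤ 4 (*-monoʳ-≤ B (n≤1+n 3)) ⟩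
    suc B * 4         ≡⟨ *-comm (suc B) 4 ⟩
    4 * suc B         ≤⟨ *-monoʳ-≤ 4 (m≤m*n (suc B) P ⦃ >-nonZero (1≤^ B (degree g)) ⦄) ⟩
    4 * (suc B * P)   ∎
  five : cost B g ≤ coefficient g * (suc B * P)
  five = ≤-trans (cost≤ B g) (*-monoʳ-≤ (coefficient g) (m≤n*m P (suc B)))

length-collect : ∀ {A : Set} n (f : ℕ → List A) {c} → (∀ i → length (f i) ≤ c) →
                 length (collect n f) ≤ n * c
length-collect zero    f f≤ = z≤n
length-collect (suc n) f {c} f≤ = begin
  length (collect n f ++ f n)          ≡⟨ length-++ (collect n f) ⟩
  length (collect n f) + length (f n)  ≤⟨ +-mono-≤ (length-collect n f f≤) (f≤ n) ⟩
  n * c + c                            ≡⟨ +-comm (n * c) c ⟩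
  c + n * c                            ∎
  where open ≤-Reasoning

-- Semantics of loop programs and correctness of the compiled code

module _ (x : Word) where

  module _ (α : ℕ → ℕ) where

    value : ∀ {s m} → (ℕ → ℕ) → Term s m → ℕ
    value ρ (var l)    = ρ l
    value ρ (lit c)    = c
    value ρ (input t)  = nth x (value ρ t)
    value ρ (stored t) = α (value ρ t)
    value ρ (t ⊕ u)    = value ρ t + value ρ u
    value ρ (t ⊖ u)    = value ρ t ∸ value ρ u

    ⟦_⟧ : ∀ {s m} → Gen s m → (ℕ → ℕ) → Word
    ⟦ put t ⟧ ρ                      = [ value ρ t ]
    ⟦ g ⊙ h ⟧ ρ                      = ⟦ g ⟧ ρ ++ ⟦ h ⟧ ρ
    ⟦ when t g ⟧ ρ                   = keep (value ρ t) (⟦ g ⟧ ρ)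
    ⟦ for {m} t g ⟧ ρ                = collect (value ρ t) (λ i → ⟦ g ⟧ (ρ [ m ↦ i ]))
    ⟦ letHorner {m} b ts g ⟧ ρ       =
      ⟦ g ⟧ (ρ [ m ↦ horner (value ρ b) 0 (map (value ρ) ts) ])

    -- What `cost B` presupposes: `B` bounds each loop length and each Horner base. Loop bodies must
    -- comply for every `i`, attained or not; the programs below do, since none of their bounds
    -- mentions a loop variable.
    Bounded : ∀ {s m} → ℕ → (ℕ → ℕ) → Gen s m → Set
    Bounded B ρ (put t)                = ⊤
    Bounded B ρ (g ⊙ h)                = Bounded B ρ g × Bounded B ρ h
    Bounded B ρ (when t g)             = Bounded B ρ g
    Bounded B ρ (for {m} t g)          = value ρ t ≤ B × (∀ i → Bounded B (ρ [ m ↦ i ]) g)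
    Bounded B ρ (letHorner {m} b ts g) =
      value ρ b ≤ B × Bounded B (ρ [ m ↦ horner (value ρ b) 0 (map (value ρ) ts) ]) g

  -- A Hoare triple for total correctness with a time bound; `_⟫_` is its composition rule.
  Reaches : Cmd → State → ℕ → (State → Set) → Set
  Reaches c s b Q = ∃[ s′ ] ∃[ t ] (x ⊢ c , s ⇓ s′ in-steps t) × t ≤ b × Q s′

  infixr 4 _⟫_
  _⟫_ : ∀ {c c′ s b b′ P Q} → Reaches c s b P → (∀ {s′} → P s′ → Reaches c′ s′ b′ Q) →
        Reaches (c ⨾ c′) s (b + b′) Q
  (_ , _ , run , t≤b , p) ⟫ next =
    let _ , _ , run′ , t′≤b′ , q = next p in
    _ , _ , seq run run′ , +-mono-≤ t≤b t′≤b′ , q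

  weaken : ∀ {c s b b′ P Q} → b ≤ b′ → (∀ {s′} → P s′ → Q s′) → Reaches c s b P → Reaches c s b′ Q
  weaken b≤b′ f (s′ , t , run , t≤b , p) = s′ , t , run , ≤-trans t≤b b≤b′ , f p

  -- On `tape`, `α` is the array as the earlier stage left it; on `array`, the word written so far
  -- is itself the array.
  Sunk : Sink → (ℕ → ℕ) → Word → State → Set
  Sunk array α w s = memory s 0 ≡ length w × (∀ a → memory s (16 + a) ≡ nth w a) × output s ≡ []
  Sunk tape  α w s = (∀ a → memory s (16 + a) ≡ α a) × output s ≡ w

  record Holds (k : Sink) (m : ℕ) (α ρ : ℕ → ℕ) (w : Word) (s : State) : Set where
    constructor holds
    field
      variables : ∀ {l} → l < m → memory s (3 + l) ≡ ρ l
      sunk      : Sunk k α w s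
  open Holds

  eval-expr : ∀ {k m α ρ w s} → Holds k m α ρ w s → (t : Term k m) →
              eval x (memory s) (expr t) ≡ value α ρ t
  eval-expr H (var l {l<m}) = variables H (<ᵇ⇒< l _ l<m)
  eval-expr H (lit c)       = refl
  eval-expr H (input t)     = cong (nth x) (eval-expr H t)
  eval-expr {α = α} H (stored t)    = trans (proj₁ (sunk H) _) (cong α (eval-expr H t))
  eval-expr H (t ⊕ u)       = cong₂ _+_ (eval-expr H t) (eval-expr H u)
  eval-expr H (t ⊖ u)       = cong₂ _∸_ (eval-expr H t) (eval-expr H u)

  Free : ℕ → ℕ → Set
  Free m a = 0 ≢ a × (∀ {l} → l < m → 3 + l ≢ a) × (∀ b → 16 + b ≢ a)

  free₁ : ∀ {m} → Free m 1
  free₁ = (λ ()) , (λ _ ()) , (λ _ ())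

  free₂ : ∀ {m} → Free m 2
  free₂ = (λ ()) , (λ _ ()) , (λ _ ())

  free-variable : ∀ m → T (m <ᵇ 13) → Free m (3 + m)
  free-variable m m<13 =
    (λ ()) , (λ { l<m refl → <-irrefl refl l<m }) ,
    (λ { b refl → m+n≮m 13 b (<ᵇ⇒< _ 13 m<13) })

  frame : ∀ {k m α ρ w μ o a v} → Free m a → Holds k m α ρ w ⟨ μ , o ⟩ →
          Holds k m α ρ w ⟨ μ [ a ↦ v ] , o ⟩
  frame {array} {μ = μ} {v = v} (0≢ , v≢ , s≢) (holds vs (len , arr , out)) = holds
    (λ l<m → trans (update-other μ v (v≢ l<m)) (vs l<m))
    (trans (update-other μ v 0≢) len , (λ a → trans (update-other μ v (s≢ a)) (arr a)) , out)
  frame {tape} {μ = μ} {v = v} (0≢ , v≢ , s≢) (holds vs (arr , out)) = holds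
    (λ l<m → trans (update-other μ v (v≢ l<m)) (vs l<m))
    ((λ a → trans (update-other μ v (s≢ a)) (arr a)) , out)

  bind : ∀ {k m α ρ w s v} → Holds k m α ρ w s → memory s (3 + m) ≡ v →
         Holds k (suc m) α (ρ [ m ↦ v ]) w s
  bind {m = m} {ρ = ρ} {s = s} {v} (holds vs sk) eq = holds lemma sk
    where
    lemma : ∀ {l} → l < suc m → memory s (3 + l) ≡ (ρ [ m ↦ v ]) l
    lemma {l} l<1+m with l ≟ m
    ... | yes refl = trans eq (sym (update-same ρ m v))
    ... | no l≢m   = trans (vs (≤∧≢⇒< (≤-pred l<1+m) l≢m)) (sym (update-other ρ v l≢m))

  unbind : ∀ {k m α ρ w s v} → Holds k (suc m) α (ρ [ m ↦ v ]) w s →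
           Holds k m α ρ w s × memory s (3 + m) ≡ v
  unbind {m = m} {ρ = ρ} {v = v} (holds vs sk) =
    holds (λ l<m → trans (vs (m<n⇒m<1+n l<m)) (update-other ρ v (<⇒≢ l<m))) sk ,
    trans (vs ≤-refl) (update-same ρ m v)

  addMultiple-reaches : ∀ {k m α ρ w s} c {r a} → T (m <ᵇ 13) → Holds k m α ρ w s →
    memory s 2 ≡ c → memory s 1 ≡ a → memory s (3 + m) ≡ r →
    Reaches (addMultiple m) s (c * 3 + 1)
      (λ s′ → Holds k m α ρ w s′ × memory s′ (3 + m) ≡ r + c * a)
  addMultiple-reaches zero {r} m< H eq₂ eq₁ eq =
    _ , _ , while-stop eq₂ , ≤-refl , H , trans eq (sym (+-identityʳ r))
  addMultiple-reaches {m = m} {s = ⟨ μ , o ⟩} (suc c) {r} {a} m< H eq₂ eq₁ eq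
    with addMultiple-reaches {s = ⟨ μ [ 3 + m ↦ μ (3 + m) + μ 1 ] [ 2 ↦ μ 2 ∸ 1 ] , o ⟩} c
           m< (frame free₂ (frame (free-variable m m<) H)) (cong (_∸ 1) eq₂) eq₁
           (trans (update-same μ (3 + m) _) (cong₂ _+_ eq eq₁))
  ... | s′ , t , run , t≤ , H′ , eq′ =
    s′ , _ , while-step (λ eq₀ → 1+n≢0 (trans (sym eq₂) eq₀)) (seq assign assign) run ,
    s≤s (s≤s (s≤s t≤)) , H′ , trans eq′ (+-assoc r a (c * a))

  digits-reaches : ∀ {k m α ρ w s B} (b : Term k m) ts {r} → T (m <ᵇ 13) → Holds k m α ρ w s →
    value α ρ b ≤ B → memory s (3 + m) ≡ r →
    Reaches (digits m b ts) s (length ts * (4 + B * 3) + 1)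
      (λ s′ → Holds k m α ρ w s′ × memory s′ (3 + m) ≡ horner (value α ρ b) r (map (value α ρ) ts))
  digits-reaches b [] m< H b≤B eq = _ , _ , skip , ≤-refl , H , eq
  digits-reaches {k} {m} {α} {ρ} {w} {⟨ μ , o ⟩} {B} b (t ∷ ts) {r} m< H b≤B eq
    with addMultiple-reaches {s = ⟨ μ₃ , o ⟩} (value α ρ b) m<
           (frame (free-variable m m<) H₂) (eval-expr H₁ b) eq (trans (update-same μ₂ (3 + m) _) (eval-expr H₂ t))
    where
    μ₁ = μ [ 1 ↦ μ (3 + m) ]
    μ₂ = μ₁ [ 2 ↦ eval x μ₁ (expr b) ]
    μ₃ = μ₂ [ 3 + m ↦ eval x μ₂ (expr t) ]
    H₁ : Holds k m α ρ w ⟨ μ₁ , o ⟩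
    H₁ = frame free₁ H
    H₂ : Holds k m α ρ w ⟨ μ₂ , o ⟩
    H₂ = frame free₂ H₁
  ... | s₁ , _ , run , t≤ , H′ , eq′
    with digits-reaches b ts m< H′ b≤B (trans eq′ (trans (+-comm (value α ρ t) _)
           (cong (_+ value α ρ t) (*-comm (value α ρ b) r))))
  ... | s₂ , _ , run′ , t′≤ , post =
    s₂ , _ , seq (seq assign (seq assign (seq assign run))) run′ ,
    ≤-trans (+-mono-≤ (s≤s (s≤s (s≤s (≤-trans t≤ (+-monoˡ-≤ 1 (*-monoˡ-≤ 3 b≤B)))))) t′≤)
      (≤-reflexive (trans (cong (λ c → 3 + c + (length ts * (4 + B * 3) + 1)) (+-comm (B * 3) 1))
        (sym (+-assoc (4 + B * 3) (length ts * (4 + B * 3)) 1)))) , post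

  Complies : ∀ {k m} → ℕ → (ℕ → ℕ) → (ℕ → ℕ) → Word → State → Gen k m → Set
  Complies {k} {m} B α ρ w s g =
    Reaches (compile g) s (cost B g) (Holds k m α ρ (w ++ ⟦_⟧ α g ρ))

  compile-correct : ∀ {k m α ρ w s} B (g : Gen k m) → Bounded α B ρ g →
    Holds k m α ρ w s → Complies B α ρ w s g

  -- Induction on the number `c` of iterations left. The bound `t` is evaluated anew at each test,
  -- but it cannot mention variable `m`, so its value persists.
  for-correct : ∀ {k m α ρ w s} B {m<} c i (t : Term k m) (g : Gen k (suc m)) →
    (∀ j → Bounded α B (ρ [ m ↦ j ]) g) → i + c ≡ value α ρ t →
    Holds k m α ρ (w ++ collect i (λ j → ⟦_⟧ α g (ρ [ m ↦ j ]))) s → memory s (3 + m) ≡ i →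
    Reaches (whileNonZero expr t ⊖ mem (lit (3 + m)) loop
               (compile g ⨾ mem[ lit (3 + m) ]≔ mem (lit (3 + m)) ⊕ lit 1))
      s (c * (2 + cost B g) + 1) (Holds k m α ρ (w ++ ⟦_⟧ α (for {_} {_} {m<} t g) ρ))
  for-correct {m = m} {α} {ρ} {w} {s} B {m<} zero i t g bdd eq H eqᵢ =
    _ , _ , while-stop (m≤n⇒m∸n≡0 (≤-reflexive (trans (eval-expr H t) (trans (sym eq′) (sym eqᵢ))))) , ≤-refl ,
    subst (λ j → Holds _ _ _ _ (w ++ collect j (λ j → ⟦_⟧ α g (ρ [ m ↦ j ]))) s) eq′ H
    where eq′ = trans (sym (+-identityʳ i)) eq
  for-correct {k} {m} {α} {ρ} {w} {s} B {m<} (suc c) i t g bdd eq H eqᵢ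
    with compile-correct B g (bdd i) (bind H eqᵢ)
  ... | ⟨ μ , o ⟩ , _ , run , t≤ , H′
    with for-correct {k} {m} {α} {ρ} {w} {⟨ μ [ 3 + m ↦ μ (3 + m) + 1 ] , o ⟩} B {m<} c (suc i) t g bdd
           (trans (sym (+-suc i c)) eq)
           (subst (λ v → Holds k m α ρ v _) (++-assoc w _ _) (frame (free-variable m m<) (proj₁ (unbind H′))))
           (trans (update-same μ (3 + m) _) (trans (+-comm _ 1) (cong suc (proj₂ (unbind H′)))))
  ... | s′ , _ , run′ , t′≤ , H″ =
    s′ , _ , while-step nonzero (seq run assign) run′ ,
    ≤-trans (s≤s (+-mono-≤ (+-monoˡ-≤ 1 t≤) t′≤))
      (≤-reflexive (trans (cong (λ a → suc (a + (c * (2 + cost B g) + 1))) (+-comm (cost B g) 1))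
        (sym (+-assoc (2 + cost B g) (c * (2 + cost B g)) 1)))) , H″
    where
    nonzero : eval x (memory s) (expr t) ∸ memory s (3 + m) ≢ 0
    nonzero eq₀ = m+1+n≰m i (≤-trans (≤-reflexive (trans eq (sym (eval-expr H t))))
      (subst (eval x (memory s) (expr t) ≤_) eqᵢ (m∸n≡0⇒m≤n eq₀)))

  compile-correct {array} {m} {α} {ρ} {w} {⟨ μ , o ⟩} B (put {_} {m<14} t) bdd H@(holds vs (len , arr , out)) =
    _ , _ , seq assign assign , ≤-refl , holds
      (λ {l} l<m → trans (update-other μ _ (below l (<-≤-trans l<m (≤-pred (<ᵇ⇒< m 14 m<14))))) (vs l<m))
      (trans (+-comm (μ 0) 1) (trans (cong suc len) (trans (+-comm 1 (length w)) (sym (length-++ w)))) ,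
       lemma , out)
    where
    below : ∀ l → l < 13 → 3 + l ≢ 16 + μ 0
    below l l<13 refl = m+n≮m 13 (μ 0) l<13
    v = eval x μ (expr t)
    lemma : ∀ a → (μ [ 16 + μ 0 ↦ v ]) (16 + a) ≡ nth (w ++ [ value α ρ t ]) a
    lemma a with a ≟ μ 0
    ... | yes refl = trans (update-same μ (16 + μ 0) v) (trans (eval-expr H t)
                       (sym (trans (cong (nth _) len) (nth-++-length w _))))
    ... | no a≢    = trans (update-other μ v (a≢ ∘ +-cancelˡ-≡ 16 _ _)) (trans (arr a)
                       (sym (nth-++-other w _ (λ eq → a≢ (trans eq (sym len))))))
  compile-correct {tape} B (put t) bdd H@(holds vs (arr , out)) =
    _ , _ , emit , s≤s z≤n , holds vs (arr , cong₂ (λ w v → w ++ [ v ]) out (eval-expr H t))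
  compile-correct {w = w} B (g ⊙ h) (bdd , bdd′) H =
    weaken ≤-refl (subst (λ v → Holds _ _ _ _ v _) (++-assoc w _ _))
      (compile-correct B g bdd H ⟫ compile-correct B h bdd′)
  compile-correct {α = α} {ρ} {w} B (when t g) bdd H with value α ρ t | eval-expr H t
  ... | zero  | eq = _ , _ , if-else eq skip , m≤m+n 2 _ ,
                     subst (λ v → Holds _ _ _ _ v _) (sym (++-identityʳ w)) H
  ... | suc c | eq with compile-correct B g bdd H
  ...   | s′ , _ , run , t≤ , H′ =
    s′ , _ , if-then (λ eq₀ → 1+n≢0 (trans (sym eq) eq₀)) run , s≤s (m≤n⇒m≤1+n t≤) , H′
  compile-correct {m = m} {α} {ρ} {w} {⟨ μ , o ⟩} B (for {_} {m<} t g) (t≤B , bdd) H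
    with for-correct {s = ⟨ μ [ 3 + m ↦ 0 ] , o ⟩} B {m<} (value α ρ t) 0 t g bdd refl
           (subst (λ v → Holds _ _ _ _ v _) (sym (++-identityʳ w)) (frame (free-variable m m<) H))
           (update-same μ (3 + m) 0)
  ... | s′ , _ , run , t≤ , H′ =
    s′ , _ , seq assign run ,
    s≤s (≤-trans t≤ (≤-trans (≤-reflexive (+-comm _ 1)) (s≤s (*-monoˡ-≤ (2 + cost B g) t≤B)))) , H′
  compile-correct {m = m} {α} {ρ} {w} {⟨ μ , o ⟩} B (letHorner {_} {m<} b ts g) (b≤B , bdd) H
    with digits-reaches {s = ⟨ μ [ 3 + m ↦ 0 ] , o ⟩} b ts m< (frame (free-variable m m<) H) b≤B
           (update-same μ (3 + m) 0)
  ... | s₁ , _ , run , t≤ , H₁ , eq with compile-correct B g bdd (bind H₁ eq)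
  ...   | s₂ , _ , run′ , t′≤ , H₂ =
    s₂ , _ , seq assign (seq run run′) ,
    s≤s (≤-trans (+-mono-≤ t≤ t′≤) (≤-reflexive (cong (_+ cost B g) (+-comm _ 1)))) , proj₁ (unbind H₂)

  -- Each number written takes a step. Applied to the first stage, this bounds the number of
  -- vertices of the constructed graph.
  length≤cost : ∀ {s m α ρ} B (g : Gen s m) → Bounded α B ρ g → length (⟦_⟧ α g ρ) ≤ cost B g
  length≤cost B (put t) bdd = s≤s z≤n
  length≤cost {α = α} {ρ} B (g ⊙ h) (bdd , bdd′) =
    ≤-trans (≤-reflexive (length-++ (⟦_⟧ α g ρ))) (+-mono-≤ (length≤cost B g bdd) (length≤cost B h bdd′))
  length≤cost {α = α} {ρ} B (when t g) bdd with value α ρ t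
  ... | zero  = z≤n
  ... | suc _ = m≤n⇒m≤o+n 2 (length≤cost B g bdd)
  length≤cost {α = α} {ρ} B (for {m} {m<} t g) (t≤B , bdd) = begin
    length (⟦_⟧ α (for {_} {m} {m<} t g) ρ)
      ≤⟨ length-collect (value α ρ t) _ (λ i → length≤cost B g (bdd i)) ⟩
    value α ρ t * cost B g   ≤⟨ *-mono-≤ t≤B (m≤n+m (cost B g) 2) ⟩
    B * (2 + cost B g)       ≤⟨ m≤n+m _ 2 ⟩
    2 + B * (2 + cost B g)   ∎
    where open ≤-Reasoning
  length≤cost B (letHorner b ts g) (b≤B , bdd) = m≤n⇒m≤o+n _ (length≤cost B g bdd)

-- cost, sealed: on the concrete programs below it unfolds to enormous terms.
opaque
  budget : ∀ {s m} → ℕ → Gen s m → ℕ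
  budget = cost

  budget≤ : ∀ {s m} B (g : Gen s m) → budget B g ≤ coefficient g * suc B ^ degree g
  budget≤ = cost≤

  length≤budget : ∀ x {s m α ρ} B (g : Gen s m) → Bounded x α B ρ g → length (⟦_⟧ x α g ρ) ≤ budget B g
  length≤budget = length≤cost

  compile-reaches : ∀ x {k m α ρ w s} B (g : Gen k m) → Bounded x α B ρ g → Holds x k m α ρ w s →
    Reaches x (compile g) s (budget B g) (Holds x k m α ρ (w ++ ⟦_⟧ x α g ρ))
  compile-reaches = compile-correct

-- Finite subsets

enumerate : ∀ {N} (S : Subset N) → Fin ∣ S ∣ → Fin N
enumerate (true ∷ S)  zero    = zero
enumerate (true ∷ S)  (suc x) = suc (enumerate S x)
enumerate (false ∷ S) x       = suc (enumerate S x)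

enumerate-∈ : ∀ {N} (S : Subset N) x → enumerate S x ∈ˢ S
enumerate-∈ (true ∷ S)  zero    = here
enumerate-∈ (true ∷ S)  (suc x) = there (enumerate-∈ S x)
enumerate-∈ (false ∷ S) x       = there (enumerate-∈ S x)

enumerate-injective : ∀ {N} (S : Subset N) → Injective _≡_ _≡_ (enumerate S)
enumerate-injective (true ∷ S)  {zero}  {zero}  eq = refl
enumerate-injective (true ∷ S)  {suc x} {suc y} eq = cong suc (enumerate-injective S (Fin.suc-injective eq))
enumerate-injective (false ∷ S) eq = enumerate-injective S (Fin.suc-injective eq)

enumerate-surjective : ∀ {N} (S : Subset N) {y} → y ∈ˢ S → ∃[ x ] enumerate S x ≡ y
enumerate-surjective (true ∷ S)  {zero}  here      = zero , refl
enumerate-surjective (true ∷ S)  {suc y} (there p) =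
  let x , eq = enumerate-surjective S p in suc x , cong suc eq
enumerate-surjective (false ∷ S) {suc y} (there p) =
  let x , eq = enumerate-surjective S p in x , cong suc eq

module _ {m N : ℕ} (f : Fin m → Fin N) (f-injective : Injective _≡_ _≡_ f) where

  injective⇒≤∣∣ : ∀ {S} → (∀ x → f x ∈ˢ S) → m ≤ ∣ S ∣
  injective⇒≤∣∣ {S} f∈ = Fin.injective⇒≤ {f = λ x → proj₁ (index x)} λ {x} {y} eq →
    f-injective (trans (sym (proj₂ (index x))) (trans (cong (enumerate S) eq) (proj₂ (index y))))
    where
    index : ∀ x → ∃[ i ] enumerate S i ≡ f x
    index x = enumerate-surjective S (f∈ x)

  image : Subset N
  image = Vec.tabulate λ y → does (Fin.any? λ x → f x Fin.≟ y)

  ∈-image : ∀ x → f x ∈ˢ image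
  ∈-image x = Vec.lookup⇒[]= (f x) image (trans (Vec.lookup∘tabulate _ (f x)) (dec-true (Fin.any? _) (x , refl)))

  image-∈ : ∀ {y} → y ∈ˢ image → ∃[ x ] f x ≡ y
  image-∈ {y} y∈ with Fin.any? (λ x → f x Fin.≟ y)
                    | trans (sym (Vec.lookup∘tabulate (λ y → does (Fin.any? λ x → f x Fin.≟ y)) y))
                        (Vec.[]=⇒lookup y∈)
  ... | yes p | _ = p
  ... | no _  | ()

  ∣image∣ : ∣ image ∣ ≡ m
  ∣image∣ = ≤-antisym
    (Fin.injective⇒≤ {f = λ i → proj₁ (preimage i)} λ {i} {j} eq → enumerate-injective image
      (trans (sym (proj₂ (preimage i))) (trans (cong f eq) (proj₂ (preimage j)))))
    (injective⇒≤∣∣ ∈-image)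
    where
    preimage : ∀ i → ∃[ x ] f x ≡ enumerate image i
    preimage i = image-∈ (enumerate-∈ image i)

-- A member outside the image would extend `f` to an injection of `suc m` elements into `S`.
onto-subset : ∀ {m N} (f : Fin m → Fin N) → Injective _≡_ _≡_ f → ∀ {S} → (∀ x → f x ∈ˢ S) →
              ∣ S ∣ ≡ m → ∀ {y} → y ∈ˢ S → ∃[ x ] f x ≡ y
onto-subset {m} {N} f f-inj {S} f∈ size {y} y∈ with Fin.any? (λ x → f x Fin.≟ y)
... | yes p = p
... | no ¬p = ⊥-elim (<-irrefl (sym size) (injective⇒≤∣∣ f′ f′-inj f′∈))
  where
  f′ : Fin (suc m) → Fin N
  f′ zero    = y
  f′ (suc x) = f x
  f′-inj : Injective _≡_ _≡_ f′
  f′-inj {zero}  {zero}  eq = refl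
  f′-inj {zero}  {suc _} eq = ⊥-elim (¬p (_ , sym eq))
  f′-inj {suc _} {zero}  eq = ⊥-elim (¬p (_ , eq))
  f′-inj {suc _} {suc _} eq = cong suc (f-inj eq)
  f′∈ : ∀ x → f′ x ∈ˢ S
  f′∈ zero    = y∈
  f′∈ (suc x) = f∈ x

constant : ∀ {k} (f : Fin k → ℕ) → (∀ j j′ → toℕ j′ ≡ suc (toℕ j) → f j ≡ f j′) → ∀ j j′ → f j ≡ f j′
constant {suc k} f step j j′ = trans (sym (from-zero f step j)) (from-zero f step j′)
  where
  from-zero : ∀ {k} (f : Fin (suc k) → ℕ) → (∀ j j′ → toℕ j′ ≡ suc (toℕ j) → f j ≡ f j′) → ∀ j → f zero ≡ f j
  from-zero f step zero = refl
  from-zero {suc k} f step (suc j) = trans (step zero (suc zero) refl)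
    (from-zero (f ∘ suc) (λ j j′ eq → step (suc j) (suc j′) (cong suc eq)) j)

-- The gadgets and their distances

data Axis : Set where
  row col : Axis

data Side : Set where
  near far : Side

Cell Choice : Set
Cell   = ℕ × ℕ
Choice = ℕ × ℕ

next : Axis → Cell → Cell
next row (i , j) = i , suc j
next col (i , j) = suc i , j

coordinate : Axis → Choice → ℕ
coordinate row (u , v) = u
coordinate col (u , v) = v

next-injective : ∀ δ {c c′} → next δ c ≡ next δ c′ → c ≡ c′
next-injective row refl = refl
next-injective col refl = refl

next-≢ : ∀ δ {c} → next δ c ≢ c
next-≢ row eq = 1+n≢n (cong proj₂ eq)
next-≢ col eq = 1+n≢n (cong proj₁ eq)

-- port δ near c a leads to the check between c and next δ c, and port δ far c a to
-- the one before c; test δ c t belongs to the check before c. The tail of a cell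
-- consists of both its pendant paths: b runs up to 2 d, the candidates sit at b = d.
data Label : Set where
  cand : Cell → Choice → Label
  link : Cell → Choice → ℕ → Label
  port : Axis → Side → Cell → Choice → Label
  tail : Cell → ℕ → Label
  test : Axis → Cell → ℕ → Label

data Slot : Set where
  cellSlot   : Cell → Slot
  checkSlot  : Axis → Cell → Slot
  choiceSlot : Cell → Choice → Slot

-- Slots are far apart on a track; (σ , b , r) is the unit interval that starts at
-- b + ε r in the slot σ, where ε is so small that no ε r reaches 1.
Place : Set
Place = Slot × ℕ × ℕ

Meets : Place → Place → Set
Meets (σ , b , r) (σ′ , b′ , r′) =
  σ ≡ σ′ × (b ≡ b′ ⊎ (b′ ≡ suc b × r′ ≤ r) ⊎ (b ≡ suc b′ × r ≤ r′))

socket : Side → Axis → Cell → Cell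
socket near δ c = next δ c
socket far  δ c = c

socketBlock : Side → ℕ
socketBlock near = 0
socketBlock far  = 2

-- Tests lie in block 1 at rank `t`. From block 0 a port meets them iff `t` is at most its rank;
-- from block 2 the comparison is reversed, and the successor makes it strict.
socketRank : Side → Axis → Choice → ℕ
socketRank near δ a = coordinate δ a
socketRank far  δ a = suc (coordinate δ a)

-- Balls of radius `d` around candidates and around path ends

module Construction (e : ℕ) where

  d : ℕ
  d = suc (suc e)

  -- Links, tails and tests need one interval only and repeat it on the other track. There, their
  -- slots contain nothing but vertices of the same kind, so the copies create no new adjacency.
  place : Track → Label → Place
  place track₁ (cand c a)        = cellSlot c , d , 0
  place track₂ (cand c a)        = choiceSlot c a , 0 , 0
  place _      (link c a m)      = choiceSlot c a , suc m , 0
  place track₁ (port δ σ c a)    = checkSlot δ (socket σ δ c) , socketBlock σ , socketRank σ δ a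
  place track₂ (port δ σ c a)    = choiceSlot c a , suc e , 0
  place _      (tail c b)        = cellSlot c , b , 0
  place _      (test δ c t)      = checkSlot δ c , 1 , t

  Adjacent : Label → Label → Set
  Adjacent y y′ = ∃[ τ ] Meets (place τ y) (place τ y′)

  block≤ : ∀ {σ b r σ′ b′ r′} → Meets (σ , b , r) (σ′ , b′ , r′) → b′ ≤ suc b
  block≤ (_ , inj₁ refl)              = n≤1+n _
  block≤ (_ , inj₂ (inj₁ (refl , _))) = ≤-refl
  block≤ (_ , inj₂ (inj₂ (refl , _))) = m≤n⇒m≤1+n (n≤1+n _)

  block≥ : ∀ {σ b r σ′ b′ r′} → Meets (σ , b , r) (σ′ , b′ , r′) → b ≤ suc b′
  block≥ (_ , inj₁ refl)              = n≤1+n _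
  block≥ (_ , inj₂ (inj₁ (refl , _))) = m≤n⇒m≤1+n (n≤1+n _)
  block≥ (_ , inj₂ (inj₂ (refl , _))) = ≤-refl

  checkSlot-injective : ∀ {δ δ′ c c′} → checkSlot δ (next δ c) ≡ checkSlot δ′ (next δ′ c′) → c ≡ c′
  checkSlot-injective {row} {row} refl = refl
  checkSlot-injective {col} {col} refl = refl

  Invariant : (ℕ → Label → Set) → Set
  Invariant P = ∀ {l} y y′ → suc l ≤ d → P l y → Adjacent y y′ → P (suc l) y′

  -- Among the vertices present, this is the exact ball of radius `d` around `cand c a`, by
  -- `within⇒covers` and `covers⇒within`: all of cell `c`, including the chains of its other
  -- candidates, and part of the tests around it.
  Covers : Cell → Choice → Label → Set
  Covers c a (cand c′ _)     = c′ ≡ c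
  Covers c a (link c′ _ _)   = c′ ≡ c
  Covers c a (port _ _ c′ _) = c′ ≡ c
  Covers c a (tail c′ _)     = c′ ≡ c
  Covers c a (test δ c′ t)   =
    (c′ ≡ next δ c × t ≤ coordinate δ a) ⊎ (c′ ≡ c × suc (coordinate δ a) ≤ t)

  module _ (c : Cell) (a : Choice) where

    -- A vertex at depth `m` of the candidate's own chain is reached at distance `m`; in the chain
    -- of another candidate of the cell it takes one step more.
    Level : Cell → Choice → ℕ → ℕ → Set
    Level c′ a′ m l = (c′ ≡ c × a′ ≡ a × m ≤ l) ⊎ (c′ ≡ c × m < l)

    -- Bounds the ball around cand c a: closed under adjacency only while l < d.
    Reach : ℕ → Label → Set
    Reach l (cand c′ a′)     = Level c′ a′ 0 l
    Reach l (link c′ a′ m)   = Level c′ a′ (suc m) l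
    Reach l (port _ _ c′ a′) = Level c′ a′ (suc e) l
    Reach l (tail c′ b)      = c′ ≡ c
    Reach l (test δ c′ t)    = d ≤ l × Covers c a (test δ c′ t)

    level-step : ∀ {c′ a′ m m′ l} → m′ ≤ suc m → Level c′ a′ m l → Level c′ a′ m′ (suc l)
    level-step m′≤ (inj₁ (p , q , m≤l)) = inj₁ (p , q , ≤-trans m′≤ (s≤s m≤l))
    level-step m′≤ (inj₂ (p , m<l))     = inj₂ (p , s≤s (≤-trans m′≤ m<l))

    level-cell : ∀ {c′ a′ m l} → Level c′ a′ m l → c′ ≡ c
    level-cell (inj₁ (p , _)) = p
    level-cell (inj₂ (p , _)) = p

    -- Ports have depth `d - 1`. Those of the other candidates are bounded by distance `d` from
    -- below, too late for a further step, so whoever steps on from a port stands at an own port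
    -- after exactly `d - 1` steps.
    top-level : ∀ {c′ a′ l} → suc l ≤ d → Level c′ a′ (suc e) l → c′ ≡ c × a′ ≡ a × suc e ≡ l
    top-level l<d (inj₁ (p , q , m≤l)) = p , q , ≤-antisym m≤l (≤-pred l<d)
    top-level l<d (inj₂ (p , m<l))     = ⊥-elim (<-irrefl refl (≤-trans m<l (≤-pred l<d)))

    -- Pairs whose slots differ in kind are refuted by the slot equation and do not appear. The
    -- decisive cases are port to test, settled by `top-level`, and near against far port, where
    -- blocks 0 and 2 do not touch: no cell leaks into the next one through a check.
    reach-step : Invariant Reach
    reach-step (cand _ _) (cand _ _) l<d r (track₁ , refl , _) = inj₂ (level-cell r , s≤s z≤n)
    reach-step (cand _ _) (cand _ _) l<d r (track₂ , refl , _) = level-step z≤n r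
    reach-step (cand _ _) (link _ _ m) l<d r (track₂ , M@(refl , _)) = level-step (block≤ M) r
    reach-step (cand _ _) (port _ near _ _) l<d r (track₂ , M@(refl , _)) = level-step (block≤ M) r
    reach-step (cand _ _) (port _ far _ _)  l<d r (track₂ , M@(refl , _)) = level-step (block≤ M) r
    reach-step (cand _ _) (tail _ b) l<d r (track₁ , refl , _) = level-cell r
    reach-step (link _ _ _) (cand _ _) l<d r (track₂ , M@(refl , _)) = level-step (block≤ M) r
    reach-step (link _ _ _) (link _ _ _) l<d r (track₁ , M@(refl , _)) = level-step (block≤ M) r
    reach-step (link _ _ _) (link _ _ _) l<d r (track₂ , M@(refl , _)) = level-step (block≤ M) r
    reach-step (link _ _ _) (port _ near _ _) l<d r (track₂ , M@(refl , _)) = level-step (block≤ M) r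
    reach-step (link _ _ _) (port _ far _ _)  l<d r (track₂ , M@(refl , _)) = level-step (block≤ M) r
    reach-step (tail _ _) (cand _ _) l<d r (track₁ , refl , _) = inj₂ (r , s≤s z≤n)
    reach-step (tail _ _) (tail _ _) l<d r (track₁ , refl , _) = r
    reach-step (tail _ _) (tail _ _) l<d r (track₂ , refl , _) = r
    reach-step (test _ _ _) _ l<d (d≤l , _) _ = ⊥-elim (<-irrefl refl (≤-trans l<d d≤l))
    reach-step (port _ σ _ _) (cand _ _) l<d r (track₂ , M@(refl , _)) = level-step z≤n r
    reach-step (port _ σ _ _) (link _ _ _) l<d r (track₂ , M@(refl , _)) = level-step (block≤ M) r
    reach-step (port _ σ _ _) (port _ σ′ _ _) l<d r (track₂ , M@(refl , _)) = level-step (block≤ M) r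
    -- All near ports of a check share block 0 and meet whatever their ranks. A step between them
    -- arrives at distance `d`, where `Level` admits the ports of other candidates.
    reach-step {l} (port _ near _ _) (port _ near _ _) l<d r (track₁ , eq , _) =
      let p , _ , q = top-level l<d r in inj₂ (trans (sym (checkSlot-injective eq)) p , s≤s (≤-reflexive q))
    reach-step (port _ near _ _) (port _ far _ _) l<d r (track₁ , M@(_ , _)) with () ← ≤-pred (block≤ M)
    reach-step (port δ near _ _) (test _ _ t) l<d r (track₁ , refl , inj₂ (inj₁ (_ , t≤))) =
      let p , p′ , q = top-level l<d r in
      s≤s (≤-reflexive q) , inj₁ (cong (next δ) p , subst (λ a → t ≤ coordinate δ a) p′ t≤)
    reach-step (port _ far _ _) (port _ far _ _) l<d r (track₁ , refl , _) =
      let p , _ , q = top-level l<d r in inj₂ (p , s≤s (≤-reflexive q))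
    reach-step (port _ far _ _) (port _ near _ _) l<d r (track₁ , M@(_ , _)) with () ← ≤-pred (block≥ M)
    reach-step (port δ far _ _) (test _ _ t) l<d r (track₁ , refl , inj₂ (inj₂ (_ , <t))) =
      let p , p′ , q = top-level l<d r in
      s≤s (≤-reflexive q) , inj₂ (p , subst (λ a → suc (coordinate δ a) ≤ t) p′ <t)

    reach⇒covers : ∀ {l} y → Reach l y → Covers c a y
    reach⇒covers (cand _ _)     r       = level-cell r
    reach⇒covers (link _ _ _)   r       = level-cell r
    reach⇒covers (port _ _ _ _) r       = level-cell r
    reach⇒covers (tail _ _)     r       = r
    reach⇒covers (test _ _ _)   (_ , r) = r

  module _ (c : Cell) where

    -- The same for the two ends, tail c 0 and tail c (d + d), of the pendant paths.
    FromFirst FromLast : ℕ → Label → Set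
    FromFirst l (cand c′ _) = c′ ≡ c × d ≤ l
    FromFirst l (tail c′ b) = c′ ≡ c × b ≤ l
    FromFirst l _           = ⊥
    FromLast l (cand c′ _) = c′ ≡ c × d ≤ l
    FromLast l (tail c′ b) = c′ ≡ c × d + d ≤ b + l
    FromLast l _           = ⊥

    from-first-step : Invariant FromFirst
    from-first-step (cand _ _) _ l<d (_ , d≤l) _ = ⊥-elim (<-irrefl refl (≤-trans l<d d≤l))
    from-first-step (tail _ _) (cand _ _) l<d (p , b≤l) (track₁ , M@(refl , _)) =
      p , ≤-trans (block≤ M) (s≤s b≤l)
    from-first-step (tail _ _) (tail _ _) l<d (p , b≤l) (track₁ , M@(refl , _)) =
      p , ≤-trans (block≤ M) (s≤s b≤l)
    from-first-step (tail _ _) (tail _ _) l<d (p , b≤l) (track₂ , M@(refl , _)) =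
      p , ≤-trans (block≤ M) (s≤s b≤l)

    from-last-step : Invariant FromLast
    from-last-step (cand _ _) _ l<d (_ , d≤l) _ = ⊥-elim (<-irrefl refl (≤-trans l<d d≤l))
    from-last-step {l} (tail _ b) (cand _ _) l<d (p , ≤b) (track₁ , M@(refl , _)) =
      p , +-cancelˡ-≤ d _ _ (≤-trans ≤b (≤-trans (+-monoˡ-≤ l (block≥ M)) (≤-reflexive (sym (+-suc d l)))))
    from-last-step {l} (tail _ b) (tail _ b′) l<d (p , ≤b) (track₁ , M@(refl , _)) =
      p , ≤-trans ≤b (≤-trans (+-monoˡ-≤ l (block≥ M)) (≤-reflexive (sym (+-suc b′ l))))
    from-last-step {l} (tail _ b) (tail _ b′) l<d (p , ≤b) (track₂ , M@(refl , _)) =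
      p , ≤-trans ≤b (≤-trans (+-monoˡ-≤ l (block≥ M)) (≤-reflexive (sym (+-suc b′ l))))

  -- Solutions of the grid and perfect codes of the graph

  module Grid (n k : ℕ) (valid : Cell → Choice → ℕ) where

    Inside : Cell → Set
    Inside (i , j) = i < k × j < k

    Chosen : Cell → Choice → Set
    Chosen c a@(u , v) = Inside c × (u < n × v < n) × valid c a ≢ 0

    -- A check needs a cell on either side, hence the predecessor `c′` in the case of a test; ports
    -- at the border of the grid lead to no test.
    Present : Label → Set
    Present (cand c a)     = Chosen c a
    Present (link c a m)   = Chosen c a × m < e
    Present (port _ _ c a) = Chosen c a
    Present (tail c b)     = Inside c × (b < d ⊎ (d < b × b ≤ d + d))
    Present (test δ c t)   = (∃[ c′ ] c ≡ next δ c′) × Inside c × t < n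

    Solution : Set
    Solution = Σ[ F ∈ (Fin k → ℕ) ] (∀ i → F i < n) × (∀ i j → valid (toℕ i , toℕ j) (F i , F j) ≢ 0)

    toCell : Fin k × Fin k → Cell
    toCell (i , j) = toℕ i , toℕ j

    cellOf : Fin (k * k) → Cell
    cellOf x = toCell (remQuot {k} k x)

    cellOf-injective : ∀ {x y} → cellOf x ≡ cellOf y → x ≡ y
    cellOf-injective {x} {y} eq = trans (sym (Fin.combine-remQuot {k} k x)) (trans
      (cong₂ combine (Fin.toℕ-injective (cong proj₁ eq)) (Fin.toℕ-injective (cong proj₂ eq)))
      (Fin.combine-remQuot {k} k y))

    cellOf-inside : ∀ x → Inside (cellOf x)
    cellOf-inside x = let i , j = remQuot {k} k x in Fin.toℕ<n i , Fin.toℕ<n j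

    cellOf-combine : ∀ (i j : Fin k) → cellOf (combine i j) ≡ (toℕ i , toℕ j)
    cellOf-combine i j = cong toCell (Fin.remQuot-combine {k} i j)

    inside⇒cellOf : ∀ {c} → Inside c → ∃[ x ] cellOf x ≡ c
    inside⇒cellOf (i<k , j<k) = combine (fromℕ< i<k) (fromℕ< j<k) ,
      trans (cellOf-combine _ _) (cong₂ _,_ (Fin.toℕ-fromℕ< i<k) (Fin.toℕ-fromℕ< j<k))

    previous-inside : ∀ δ {c} → Inside (next δ c) → Inside c
    previous-inside row (i<k , j<k) = i<k , <-trans (n<1+n _) j<k
    previous-inside col (i<k , j<k) = <-trans (n<1+n _) i<k , j<k

    module _ {N : ℕ} (G : Graph N) (label : Fin N → Label)
             (adjacent : ∀ u v → Graph._~_ G u v ⇔ (u ≢ v × Adjacent (label u) (label v)))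
             (present : ∀ u → Present (label u))
             (find : ∀ {y} → Present y → ∃[ u ] label u ≡ y) where
      open Graph G

      Within : ℕ → Fin N → Fin N → Set
      Within = DistanceAtMost G

      snoc : ∀ {l u v w} → Walk G l u v → v ~ w → Walk G (suc l) u w
      snoc []      b = b ∷ []
      snoc (a ∷ p) b = a ∷ snoc p b

      within-refl : ∀ {l u} → Within l u u
      within-refl = 0 , z≤n , []

      within-step : ∀ {l u v w} → Within l u v → Adjacent (label v) (label w) → Within (suc l) u w
      within-step {v = v} {w} (l , l≤ , p) A with v Fin.≟ w
      ... | yes refl = l , m≤n⇒m≤1+n l≤ , p
      ... | no v≢w   = suc l , s≤s l≤ , snoc p (Equivalence.from (adjacent v w) (v≢w , A))

      within-mono : ∀ {l l′ u v} → l ≤ l′ → Within l u v → Within l′ u v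
      within-mono l≤l′ (l , l≤ , p) = l , ≤-trans l≤ l≤l′ , p

      neighbourhood⇒within : ∀ {u v} → ClosedNeighbourhood (power G d) u v → Within d u v
      neighbourhood⇒within (inj₁ refl)    = within-refl
      neighbourhood⇒within (inj₂ (_ , p)) = p

      within⇒neighbourhood : ∀ {u v} → Within d u v → ClosedNeighbourhood (power G d) u v
      within⇒neighbourhood {u} {v} p with v Fin.≟ u
      ... | yes v≡u = inj₁ v≡u
      ... | no v≢u  = inj₂ (v≢u ∘ sym , p)

      within-sym : ∀ {u v} → Within d u v → Within d v u
      within-sym {u} {v} p with u Fin.≟ v
      ... | yes refl = p
      ... | no u≢v   = proj₂ (Graph.~-sym (power G d) {u} {v} (u≢v , p))

      walk-invariant : ∀ {P} → Invariant P → ∀ {l l′ u v} → Walk G l u v → l + l′ ≤ d →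
                       P l′ (label u) → P (l + l′) (label v)
      walk-invariant step [] l≤ p = p
      walk-invariant {P} step {suc l} {l′} {u} {v} (_∷_ {v = w} a W) l≤ p =
        subst (λ l → P l (label v)) (+-suc l l′)
        (walk-invariant {P} step W (subst (_≤ d) (sym (+-suc l l′)) l≤)
          (step (label u) (label w) (≤-trans (s≤s (m≤n+m l′ l)) l≤) p
            (proj₂ (Equivalence.to (adjacent u w) a))))

      within-invariant : ∀ {P} → Invariant P → ∀ {u v} → P 0 (label u) → Within d u v →
                         ∃[ l ] l ≤ d × P l (label v)
      within-invariant {P} step {v = v} p (l , l≤ , W) =
        l , l≤ , subst (λ l → P l (label v)) (+-identityʳ l)
          (walk-invariant {P} step W (subst (_≤ d) (sym (+-identityʳ l)) l≤) p)

      within⇒covers : ∀ {c a u v} → label u ≡ cand c a → Within d u v → Covers c a (label v)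
      within⇒covers {c} {a} {u} {v} eq p = reach⇒covers c a (label v) (proj₂ (proj₂
        (within-invariant (reach-step c a)
          (subst (Reach c a 0) (sym eq) (inj₁ (refl , refl , z≤n))) p)))

      module _ {c a u} (chosen : Chosen c a) (u≡ : label u ≡ cand c a) where

        step-from : ∀ {l w v y y′} → label w ≡ y → label v ≡ y′ → Within l u w →
                    Adjacent y y′ → Within (suc l) u v
        step-from w≡ v≡ p A = within-step p (subst₂ Adjacent (sym w≡) (sym v≡) A)

        within-link : ∀ m {v} → m < e → label v ≡ link c a m → Within (suc m) u v
        within-link zero    m<e v≡ = step-from u≡ v≡ within-refl (track₂ , refl , inj₂ (inj₁ (refl , z≤n)))
        within-link (suc m) m<e v≡ =
          let _ , w≡ = find {link c a m} (chosen , <⇒≤ m<e) in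
          step-from w≡ v≡ (within-link m (<⇒≤ m<e) w≡) (track₂ , refl , inj₂ (inj₁ (refl , z≤n)))

        within-port : ∀ {δ σ v} → label v ≡ port δ σ c a → Within (suc e) u v
        within-port v≡ = lemma e refl v≡
          where
          -- `e` is a module parameter, so the distinction whether there are links at all is made on
          -- a copy of it.
          lemma : ∀ m → m ≡ e → ∀ {δ σ v} → label v ≡ port δ σ c a → Within (suc m) u v
          lemma zero    refl v≡ = step-from u≡ v≡ within-refl (track₂ , refl , inj₂ (inj₁ (refl , z≤n)))
          lemma (suc m) refl v≡ =
            let _ , w≡ = find {link c a m} (chosen , n<1+n m) in
            step-from w≡ v≡ (within-link m (n<1+n m) w≡) (track₂ , refl , inj₂ (inj₁ (refl , z≤n)))

        within-tail-below : ∀ m {b v} → b + suc m ≡ d → label v ≡ tail c b → Within (suc m) u v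
        within-tail-below zero {b} eq v≡ = step-from u≡ v≡ within-refl
          (track₁ , refl , inj₂ (inj₂ (trans (sym eq) (+-comm b 1) , z≤n)))
        within-tail-below (suc m) {b} eq v≡ =
          let eq′ = trans (sym (+-suc b (suc m))) eq
              _ , w≡ = find {tail c (suc b)} (proj₁ chosen , inj₁ (subst (suc b <_) eq′ (m<m+n (suc b) z<s)))
          in step-from w≡ v≡ (within-tail-below m eq′ w≡) (track₁ , refl , inj₂ (inj₂ (refl , z≤n)))

        within-tail-above : ∀ m {b v} → d + suc m ≡ b → b ≤ d + d → label v ≡ tail c b → Within (suc m) u v
        within-tail-above zero eq b≤ v≡ = step-from u≡ v≡ within-refl
          (track₁ , refl , inj₂ (inj₁ (trans (sym eq) (+-comm d 1) , z≤n)))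
        within-tail-above (suc m) {b} eq b≤ v≡ =
          let eq′ = trans (sym (+-suc d (suc m))) eq
              b′≤ = ≤-trans (n≤1+n _) (subst (_≤ d + d) (sym eq′) b≤)
              _ , w≡ = find {tail c (d + suc m)} (proj₁ chosen , inj₂ (m<m+n d z<s , b′≤))
          in step-from w≡ v≡ (within-tail-above m refl b′≤ w≡) (track₁ , refl , inj₂ (inj₁ (sym eq′ , z≤n)))

      -- Chains are entered through their candidate, which is at most one step away; a port at depth
      -- `d - 1` of another chain is thus still within `d`. Tests are approached through the own
      -- port.
      covers⇒within : ∀ {c a u} v → label u ≡ cand c a → Covers c a (label v) → Within d u v
      covers⇒within {c} {a} {u} v u≡ cov = go (label v) refl cov (present v)
        where
        chosen : Chosen c a
        chosen = subst Present u≡ (present u)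
        sibling : ∀ {w a′} → label w ≡ cand c a′ → Within 1 u w
        sibling w≡ = within-step within-refl
          (subst₂ Adjacent (sym u≡) (sym w≡) (track₁ , refl , inj₁ refl))
        via : ∀ {w} l {v} → Within 1 u w → Within l w v → Within (suc l) u v
        via l {v} (l₁ , l₁≤ , W) (l₂ , l₂≤ , W′) = l₁ + l₂ , +-mono-≤ l₁≤ l₂≤ , concat W W′
          where
          concat : ∀ {l l′ u v w} → Walk G l u v → Walk G l′ v w → Walk G (l + l′) u w
          concat []      W = W
          concat (b ∷ V) W = b ∷ concat V W
        go : ∀ y → label v ≡ y → Covers c a y → Present y → Within d u v
        go (cand _ _) v≡ refl _ = within-mono (s≤s z≤n) (sibling v≡)
        go (link _ a′ m) v≡ refl (ch , m<e) =
          let _ , w≡ = find {cand c a′} ch in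
          within-mono (s≤s (s≤s (<⇒≤ m<e))) (via (suc m) (sibling w≡) (within-link ch w≡ m m<e v≡))
        go (port _ _ _ a′) v≡ refl ch =
          let _ , w≡ = find {cand c a′} ch in via (suc e) (sibling w≡) (within-port ch w≡ v≡)
        go (tail _ b) v≡ refl (_ , inj₁ b<d) =
          let m , eq = m≤n⇒∃[o]m+o≡n b<d in
          within-mono (subst (suc m ≤_) eq (s≤s (m≤n+m m b)))
            (within-tail-below chosen u≡ m (trans (+-suc b m) eq) v≡)
        go (tail _ b) v≡ refl (_ , inj₂ (d<b , b≤)) =
          let m , eq = m≤n⇒∃[o]m+o≡n d<b
              eq′ = trans (+-suc d m) eq in
          within-mono (+-cancelˡ-≤ d _ _ (subst (_≤ d + d) (sym eq′) b≤))
            (within-tail-above chosen u≡ m eq′ b≤ v≡)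
        go (test δ _ t) v≡ (inj₁ (refl , t≤)) _ =
          let _ , w≡ = find {port δ near c a} chosen in
          step-from chosen u≡ w≡ v≡ (within-port chosen u≡ w≡) (track₁ , refl , inj₂ (inj₁ (refl , t≤)))
        go (test δ _ t) v≡ (inj₂ (refl , <t)) _ =
          let _ , w≡ = find {port δ far c a} chosen in
          step-from chosen u≡ w≡ v≡ (within-port chosen u≡ w≡) (track₁ , refl , inj₂ (inj₂ (refl , <t)))

      solution⇒code : Solution → ∃[ S ] IsPerfectCode (power G d) S × ∣ S ∣ ≡ k * k
      solution⇒code (F , F<n , F-valid) = image z z-injective , perfect , ∣image∣ z z-injective
        where
        pick : Fin (k * k) → Choice
        pick x = let i , j = remQuot {k} k x in F i , F j
        chosen : ∀ x → Chosen (cellOf x) (pick x)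
        chosen x = cellOf-inside x , (F<n _ , F<n _) , F-valid _ _
        z : Fin (k * k) → Fin N
        z x = proj₁ (find {cand (cellOf x) (pick x)} (chosen x))
        z≡ : ∀ x → label (z x) ≡ cand (cellOf x) (pick x)
        z≡ x = proj₂ (find {cand (cellOf x) (pick x)} (chosen x))
        z-injective : Injective _≡_ _≡_ z
        z-injective {x} {y} eq = cellOf-injective
          (cand-injective (trans (sym (z≡ x)) (trans (cong label eq) (z≡ y))))
          where
          cand-injective : ∀ {c a c′ a′} → cand c a ≡ cand c′ a′ → c ≡ c′
          cand-injective refl = refl
        agree : ∀ δ {x x′} → cellOf x′ ≡ next δ (cellOf x) → coordinate δ (pick x) ≡ coordinate δ (pick x′)
        agree row eq = cong F (Fin.toℕ-injective (sym (cong proj₁ eq)))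
        agree col eq = cong F (Fin.toℕ-injective (sym (cong proj₂ eq)))

        coverer : ∀ y → Present y → ∃[ x ] Covers (cellOf x) (pick x) y ×
                  (∀ x′ → Covers (cellOf x′) (pick x′) y → x ≡ x′)
        home : ∀ c → Inside c → ∃[ x ] c ≡ cellOf x × (∀ x′ → c ≡ cellOf x′ → x ≡ x′)
        home c ins = let x , eq = inside⇒cellOf ins in
          x , sym eq , λ x′ eq′ → cellOf-injective (trans eq eq′)
        coverer (cand c _)     (ins , _)       = home c ins
        coverer (link c _ _)   ((ins , _) , _) = home c ins
        coverer (port _ _ c _) (ins , _)       = home c ins
        coverer (tail c _)     (ins , _)       = home c ins
        -- `x₁` is the cell before the check and `x₂` the one after it. Both carry the same value,
        -- so comparing `t` with it selects exactly one of them.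
        coverer (test δ _ t) ((c , refl) , ins , t<n)
          with inside⇒cellOf ins | inside⇒cellOf (previous-inside δ ins)
        ... | x₂ , x₂≡ | x₁ , refl with t ≤? coordinate δ (pick x₁)
        ...   | yes t≤ = x₁ , inj₁ (refl , t≤) , λ where
          x′ (inj₁ (eq , _)) → cellOf-injective (next-injective δ eq)
          x′ (inj₂ (eq , <t)) → ⊥-elim
            (<-irrefl refl (≤-trans <t (≤-trans t≤ (≤-reflexive (agree δ (sym eq))))))
        ...   | no t≰ = x₂ , inj₂ (sym x₂≡ , subst (_< t) (agree δ x₂≡) (≰⇒> t≰)) , λ where
          x′ (inj₁ (eq , t≤)) → ⊥-elim (t≰ (subst (λ x → t ≤ coordinate δ (pick x))
                                  (cellOf-injective (sym (next-injective δ eq))) t≤))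
          x′ (inj₂ (eq , _))  → cellOf-injective (trans x₂≡ eq)

        perfect : IsPerfectCode (power G d) (image z z-injective)
        perfect u = let x , cov , unique = coverer (label u) (present u) in
          z x , (∈-image z z-injective x , within⇒neighbourhood (within-sym (covers⇒within u (z≡ x) cov))) ,
          λ (v∈ , near-v) → let x′ , eq = image-∈ z z-injective v∈ in
            trans (cong z (unique x′ (within⇒covers (z≡ x′)
              (subst (λ w → Within d w u) (sym eq) (within-sym (neighbourhood⇒within near-v)))))) eq

      module _ {S} (perfect : IsPerfectCode (power G d) S) (size : ∣ S ∣ ≡ k * k) where

        opaque
          cover : ∀ u → ∃[ v ] v ∈ˢ S × Within d v u × (∀ {w} → w ∈ˢ S → Within d w u → v ≡ w)
          cover u = let v , (v∈ , near-v) , unique = perfect u in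
            v , v∈ , within-sym (neighbourhood⇒within near-v) ,
            λ w∈ p → unique (w∈ , within⇒neighbourhood (within-sym p))

          first : ∀ x → ∃[ u ] label u ≡ tail (cellOf x) 0
          first x = find (cellOf-inside x , inj₁ z<s)

          last : ∀ x → ∃[ u ] label u ≡ tail (cellOf x) (d + d)
          last x = find (cellOf-inside x , inj₂ (m<m+n d z<s , ≤-refl))

        opaque
          z : Fin (k * k) → Fin N
          z x = proj₁ (cover (proj₁ (first x)))

          z∈ : ∀ x → z x ∈ˢ S
          z∈ x = proj₁ (proj₂ (cover (proj₁ (first x))))

          z-first : ∀ x → ∃[ l ] l ≤ d × FromFirst (cellOf x) l (label (z x))
          z-first x = let u , u≡ = first x in
            within-invariant (from-first-step (cellOf x))
              (subst (FromFirst (cellOf x) 0) (sym u≡) (refl , z≤n))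
              (within-sym (proj₁ (proj₂ (proj₂ (cover u)))))

        same-cell : ∀ {c c′ l l′} y → FromFirst c l y → FromFirst c′ l′ y → c ≡ c′
        same-cell (cand _ _) (p , _) (q , _) = trans (sym p) q
        same-cell (tail _ _) (p , _) (q , _) = trans (sym p) q

        same-cell′ : ∀ {c c′ l l′} y → FromFirst c l y → FromLast c′ l′ y → c ≡ c′
        same-cell′ (cand _ _) (p , _) (q , _) = trans (sym p) q
        same-cell′ (tail _ _) (p , _) (q , _) = trans (sym p) q

        z-injective : Injective _≡_ _≡_ z
        z-injective {x} {y} eq =
          let l , _ , p = z-first x
              _ , _ , q = z-first y
          in cellOf-injective (same-cell _ (subst (λ v → FromFirst (cellOf x) l (label v)) eq p) q)

        -- The size of the code enters here: the members serving the `k * k` first ends are distinct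
        -- and exhaust it.
        S⊆z : ∀ {w} → w ∈ˢ S → ∃[ x ] z x ≡ w
        S⊆z = onto-subset z z-injective z∈ size

        -- A tail vertex within `d` of both ends would have `b ≤ d` and `d ≤ b`, but `b = d` is left
        -- to the candidates.
        is-cand : ∀ {c l l′} y → Present y → l ≤ d → l′ ≤ d → FromFirst c l y → FromLast c l′ y →
                  ∃[ a ] y ≡ cand c a
        is-cand (cand _ a) _ _ _ (refl , _) _ = a , refl
        is-cand {l′ = l′} (tail _ b) (_ , inj₁ b<d) l≤ l′≤ _ (_ , 2d≤) =
          ⊥-elim (<⇒≱ b<d (+-cancelʳ-≤ d d b (≤-trans 2d≤ (+-monoʳ-≤ b l′≤))))
        is-cand (tail _ b) (_ , inj₂ (d<b , _)) l≤ l′≤ (_ , b≤l) _ = ⊥-elim (<⇒≱ d<b (≤-trans b≤l l≤))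

        -- The member serving the last end is `z x′` for some `x′`. Being close to a path end
        -- determines the cell, so `x′ = x`.
        z-last : ∀ x → ∃[ l ] l ≤ d × FromLast (cellOf x) l (label (z x))
        z-last x =
          let u , u≡ = last x
              w , w∈ , p , _ = cover u
              l , l≤ , q = within-invariant (from-last-step (cellOf x))
                (subst (FromLast (cellOf x) 0) (sym u≡) (refl , ≤-reflexive (sym (+-identityʳ _))))
                (within-sym p)
              x′ , w≡ = S⊆z w∈
              q′ = subst (λ v → FromLast (cellOf x) l (label v)) (sym w≡) q
              _ , _ , r = z-first x′
          in l , l≤ , subst (λ x′ → FromLast (cellOf x) l (label (z x′)))
                        (cellOf-injective (same-cell′ (label (z x′)) r q′)) q′

        opaque
          picked : ∀ x → ∃[ a ] label (z x) ≡ cand (cellOf x) a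
          picked x =
            let _ , l≤ , p = z-first x
                _ , l′≤ , q = z-last x
            in is-cand (label (z x)) (present (z x)) l≤ l′≤ p q

        pick : Fin (k * k) → Choice
        pick x = proj₁ (picked x)

        pick-chosen : ∀ x → Chosen (cellOf x) (pick x)
        pick-chosen x = subst Present (proj₂ (picked x)) (present (z x))

        within⇒covers-z : ∀ {x u y} → label u ≡ y → Within d (z x) u → Covers (cellOf x) (pick x) y
        within⇒covers-z {x} eq p = subst (Covers _ _) eq (within⇒covers (proj₂ (picked x)) p)

        covers⇒within-z : ∀ {x u y} → label u ≡ y → Covers (cellOf x) (pick x) y → Within d (z x) u
        covers⇒within-z {x} eq p = covers⇒within _ (proj₂ (picked x)) (subst (Covers _ _) (sym eq) p)

        coordinate< : ∀ δ y → coordinate δ (pick y) < n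
        coordinate< row y = proj₁ (proj₁ (proj₂ (pick-chosen y)))
        coordinate< col y = proj₂ (proj₁ (proj₂ (pick-chosen y)))

        once-covered : ∀ y → Present y → (∃[ x ] Covers (cellOf x) (pick x) y) ×
          (∀ x x′ → Covers (cellOf x) (pick x) y → Covers (cellOf x′) (pick x′) y → x ≡ x′)
        once-covered y y-present with find y-present
        ... | u , u≡ with cover u
        ... | w , w∈ , p , unique with S⊆z w∈
        ... | x , refl = (x , within⇒covers-z u≡ p) , λ x x′ q q′ → z-injective
          (trans (sym (unique (z∈ x) (covers⇒within-z u≡ q))) (unique (z∈ x′) (covers⇒within-z u≡ q′)))

        -- Were the values `p` and `q` different, the test at the larger one would be violated: for
        -- `p < q` the test `q` is covered from neither side, for `q < p` the test `p` from both.
        -- Both exist, as values are below `n`.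
        agree : ∀ δ {x x′} → cellOf x′ ≡ next δ (cellOf x) → coordinate δ (pick x) ≡ coordinate δ (pick x′)
        agree δ {x} {x′} next≡ = lemma _ _ refl refl
          where
          tested : ∀ t → t < n → (∃[ y ] Covers (cellOf y) (pick y) (test δ (cellOf x′) t)) ×
            (∀ y y′ → Covers (cellOf y) (pick y) (test δ (cellOf x′) t) →
                      Covers (cellOf y′) (pick y′) (test δ (cellOf x′) t) → y ≡ y′)
          tested t t<n = once-covered (test δ (cellOf x′) t) ((cellOf x , next≡) , cellOf-inside x′ , t<n)
          lemma : ∀ p q → coordinate δ (pick x) ≡ p → coordinate δ (pick x′) ≡ q → p ≡ q
          lemma p q p≡ q≡ with <-cmp p q
          ... | tri≈ _ eq _ = eq
          ... | tri< p<q _ _ with proj₁ (tested q (subst (_< n) q≡ (coordinate< δ x′)))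
          ...   | y , inj₁ (eq , q≤) = ⊥-elim (<⇒≱ p<q (subst (q ≤_) (trans (cong (λ y → coordinate δ (pick y))
              (cellOf-injective (next-injective δ (trans (sym eq) next≡)))) p≡) q≤))
          ...   | y , inj₂ (eq , <q) = ⊥-elim (<-irrefl
              (trans (cong (λ y → coordinate δ (pick y)) (cellOf-injective (sym eq))) q≡) <q)
          lemma p q p≡ q≡ | tri> _ _ q<p = ⊥-elim (next-≢ δ (trans (sym next≡) (cong cellOf
            (sym (proj₂ (tested p (subst (_< n) p≡ (coordinate< δ x))) x x′
              (inj₁ (next≡ , ≤-reflexive (sym p≡)))
              (inj₂ (refl , subst (_< p) (sym q≡) q<p)))))))

        module _ (diagonal : ∀ {i u v} → valid (i , i) (u , v) ≢ 0 → u ≡ v) where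

          choice : Fin k → Fin k → Choice
          choice i j = pick (combine i j)

          choice-chosen : ∀ i j → Chosen (toℕ i , toℕ j) (choice i j)
          choice-chosen i j = subst (λ c → Chosen c (choice i j)) (cellOf-combine i j) (pick-chosen (combine i j))

          F : Fin k → ℕ
          F i = coordinate row (choice i i)

          row-constant : ∀ i j j′ → coordinate row (choice i j) ≡ coordinate row (choice i j′)
          row-constant i = constant _ λ j j′ eq → agree row
            (trans (cellOf-combine i j′)
              (trans (cong (toℕ i ,_) eq) (cong (next row) (sym (cellOf-combine i j)))))

          col-constant : ∀ j i i′ → coordinate col (choice i j) ≡ coordinate col (choice i′ j)
          col-constant j = constant _ λ i i′ eq → agree col
            (trans (cellOf-combine i′ j)
              (trans (cong (_, toℕ j) eq) (cong (next col) (sym (cellOf-combine i j)))))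

          -- Row `i` carries the first component of cell `(i , i)`, column `j` the second one of
          -- cell `(j , j)`, which `diagonal` identifies with `F j`.
          F-valid : ∀ i j → valid (toℕ i , toℕ j) (F i , F j) ≢ 0
          F-valid i j = subst (λ a → valid (toℕ i , toℕ j) a ≢ 0)
            (cong₂ _,_ (row-constant i j i)
              (trans (col-constant j i j) (sym (diagonal (proj₂ (proj₂ (choice-chosen j j)))))))
            (proj₂ (proj₂ (choice-chosen i j)))

          code⇒solution : Solution
          code⇒solution = F , (λ i → proj₁ (proj₁ (proj₂ (choice-chosen i i)))) , F-valid

-- Placing the gadgets on two tracks

∈-collect⁺ : ∀ {A : Set} {y : A} n (f : ℕ → List A) {i} → i < n → y ∈ f i → y ∈ collect n f
∈-collect⁺ (suc n) f {i} i<1+n y∈ with m<1+n⇒m<n∨m≡n i<1+n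
... | inj₁ i<n  = ∈-++⁺ˡ (∈-collect⁺ n f i<n y∈)
... | inj₂ refl = ∈-++⁺ʳ (collect n f) y∈

∈-collect⁻ : ∀ {A : Set} {y : A} n (f : ℕ → List A) → y ∈ collect n f → ∃[ i ] i < n × y ∈ f i
∈-collect⁻ (suc n) f y∈ with ∈-++⁻ (collect n f) y∈
... | inj₁ p = let i , i<n , q = ∈-collect⁻ n f p in i , m<n⇒m<1+n i<n , q
... | inj₂ p = n , n<1+n n , p

∈-keep⁺ : ∀ {A : Set} {y : A} c {w} → c ≢ 0 → y ∈ w → y ∈ keep c w
∈-keep⁺ zero    c≢0 y∈ = ⊥-elim (c≢0 refl)
∈-keep⁺ (suc _) c≢0 y∈ = y∈

∈-keep⁻ : ∀ {A : Set} {y : A} c {w} → y ∈ keep c w → c ≢ 0 × y ∈ w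
∈-keep⁻ (suc _) y∈ = (λ ()) , y∈

collect-cong : ∀ {A : Set} n {f g : ℕ → List A} → (∀ i → f i ≡ g i) → collect n f ≡ collect n g
collect-cong zero    eq = refl
collect-cong (suc n) eq = cong₂ _++_ (collect-cong n eq) (eq n)

concatMap-collect : ∀ {A B : Set} (h : A → List B) n f →
                    concatMap h (collect n f) ≡ collect n (concatMap h ∘ f)
concatMap-collect h zero    f = refl
concatMap-collect h (suc n) f =
  trans (concatMap-++ h (collect n f) (f n)) (cong (_++ concatMap h (f n)) (concatMap-collect h n f))

concatMap-keep : ∀ {A B : Set} (h : A → List B) c w → concatMap h (keep c w) ≡ keep c (concatMap h w)
concatMap-keep h zero    w = refl
concatMap-keep h (suc _) w = refl

-- Starting points as numbers in base `M`

block-< : ∀ {M a a′} b b′ → b < M → a < a′ → a * M + b < a′ * M + b′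
block-< {M} {a} {a′} b b′ b<M a<a′ = begin-strict
  a * M + b       <⟨ +-monoʳ-< (a * M) b<M ⟩
  a * M + M       ≡⟨ +-comm (a * M) M ⟩
  suc a * M       ≤⟨ *-monoˡ-≤ M a<a′ ⟩
  a′ * M          ≤⟨ m≤m+n (a′ * M) b′ ⟩
  a′ * M + b′     ∎
  where open ≤-Reasoning

remainder-unique : ∀ {M a a′ b b′} → b < M → b′ < M → a * M + b ≡ a′ * M + b′ → a ≡ a′ × b ≡ b′
remainder-unique {M} {a} {a′} {b} {b′} b<M b′<M eq with <-cmp a a′
... | tri≈ _ refl _ = refl , +-cancelˡ-≡ (a * M) b b′ eq
... | tri< a<a′ _ _ = ⊥-elim (<⇒≢ (block-< b b′ b<M a<a′) eq)
... | tri> _ _ a′<a = ⊥-elim (<⇒≢ (block-< b′ b b′<M a′<a) (sym eq))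

-- The intersection of two closed intervals of length `M`, in terms of their left endpoints.
Close : ℕ → ℕ → ℕ → Set
Close M p q = p ≤ q + M × q ≤ p + M

module _ (M : ℕ) where

  horner-injective : ∀ {acc acc′} ds ds′ → length ds ≡ length ds′ → All (_< M) ds → All (_< M) ds′ →
                     horner M acc ds ≡ horner M acc′ ds′ → acc ≡ acc′ × ds ≡ ds′
  horner-injective []       []         len ps qs eq = eq , refl
  horner-injective (c ∷ ds) (c′ ∷ ds′) len (p ∷ ps) (q ∷ qs) eq =
    let eq₁ , eq₂ = horner-injective ds ds′ (suc-injective len) ps qs eq
        eq₃ , eq₄ = remainder-unique p q eq₁
    in eq₃ , cong₂ _∷_ eq₄ eq₂

  -- With `c′ = suc c + o` the inequality becomes `o * M + r′ ≤ r < M`, which forces `o = 0`.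
  successive : ∀ {c c′ r r′} → r < M → c < c′ → c′ * M + r′ ≤ c * M + r + M → c′ ≡ suc c × r′ ≤ r
  successive {c} {c′} {r} {r′} r<M c<c′ le with m≤n⇒∃[o]m+o≡n c<c′
  ... | o , refl = lemma o (+-cancelˡ-≤ (c * M + M) (o * M + r′) r
                      (≤-trans (≤-reflexive (expand c M o r′)) (≤-trans le (≤-reflexive (regroup (c * M) r M)))))
    where
    expand : ∀ c M o r′ → c * M + M + (o * M + r′) ≡ (suc c + o) * M + r′
    expand = solve-∀
    regroup : ∀ a r M → a + r + M ≡ a + M + r
    regroup = solve-∀
    lemma : ∀ o → o * M + r′ ≤ r → suc c + o ≡ suc c × r′ ≤ r
    lemma zero    r′≤ = +-identityʳ (suc c) , r′≤
    lemma (suc o) ≤r  = ⊥-elim (<⇒≱ r<M (≤-trans (m≤m+n M (o * M)) (≤-trans (m≤m+n (M + o * M) r′) ≤r)))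

  close⇒ : ∀ {c c′ r r′} → r < M → r′ < M → Close M (c * M + r) (c′ * M + r′) →
           c ≡ c′ ⊎ (c′ ≡ suc c × r′ ≤ r) ⊎ (c ≡ suc c′ × r ≤ r′)
  close⇒ {c} {c′} r<M r′<M (le , ge) with <-cmp c c′
  ... | tri≈ _ eq _ = inj₁ eq
  ... | tri< c<c′ _ _ = inj₂ (inj₁ (successive r<M c<c′ ge))
  ... | tri> _ _ c′<c = inj₂ (inj₂ (successive r′<M c′<c le))

  close-same : ∀ c {r r′} → r < M → r′ < M → Close M (c * M + r) (c * M + r′)
  close-same c {r} {r′} r<M r′<M = half r r′ r<M , half r′ r r′<M
    where
    half : ∀ r r′ → r < M → c * M + r ≤ c * M + r′ + M
    half r r′ r<M = ≤-trans (+-monoʳ-≤ (c * M) (≤-trans (<⇒≤ r<M) (m≤n+m M r′)))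
      (≤-reflexive (sym (+-assoc (c * M) r′ M)))

  close-next : ∀ c {r r′} → r < M → r′ ≤ r → Close M (c * M + r) (suc c * M + r′)
  close-next c {r} {r′} r<M r′≤r =
    ≤-trans (<⇒≤ (block-< {a = c} r r′ r<M ≤-refl)) (m≤m+n _ M) ,
    ≤-trans (+-monoʳ-≤ (suc c * M) r′≤r) (≤-reflexive (regroup M (c * M) r))
    where
    regroup : ∀ M a r → M + a + r ≡ a + r + M
    regroup = solve-∀

-- Starting points are seven-digit numbers in base M, the length of the intervals: five
-- digits for the slot, one for the block and one for the rank within it.
slotDigits : Slot → List ℕ
slotDigits (cellSlot (i , j))           = 0 ∷ i ∷ j ∷ 0 ∷ 0 ∷ []
slotDigits (checkSlot row (i , j))      = 1 ∷ i ∷ j ∷ 0 ∷ 0 ∷ []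
slotDigits (checkSlot col (i , j))      = 2 ∷ i ∷ j ∷ 0 ∷ 0 ∷ []
slotDigits (choiceSlot (i , j) (u , v)) = 3 ∷ i ∷ j ∷ u ∷ v ∷ []

slotDigits-injective : ∀ σ σ′ → slotDigits σ ≡ slotDigits σ′ → σ ≡ σ′
slotDigits-injective (cellSlot _)      (cellSlot _)      refl = refl
slotDigits-injective (checkSlot row _) (checkSlot row _) refl = refl
slotDigits-injective (checkSlot col _) (checkSlot col _) refl = refl
slotDigits-injective (choiceSlot _ _)  (choiceSlot _ _)  refl = refl
slotDigits-injective (cellSlot _)      (checkSlot row _) ()
slotDigits-injective (cellSlot _)      (checkSlot col _) ()
slotDigits-injective (choiceSlot _ _)  (checkSlot row _) ()
slotDigits-injective (choiceSlot _ _)  (checkSlot col _) ()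

position : ℕ → Place → ℕ
position M (σ , b , r) = horner M 0 (slotDigits σ ++ b ∷ r ∷ [])

code : ℕ → Slot → ℕ
code M σ = horner M 0 (slotDigits σ)

position≡ : ∀ M σ b r → position M (σ , b , r) ≡ (code M σ * M + b) * M + r
position≡ M (cellSlot _)      b r = refl
position≡ M (checkSlot row _) b r = refl
position≡ M (checkSlot col _) b r = refl
position≡ M (choiceSlot _ _)  b r = refl

length-slotDigits : ∀ σ → length (slotDigits σ) ≡ 5
length-slotDigits (cellSlot _)      = refl
length-slotDigits (checkSlot row _) = refl
length-slotDigits (checkSlot col _) = refl
length-slotDigits (choiceSlot _ _)  = refl

-- `suc b < M` rather than `b < M`: otherwise the last block of a slot could touch the first one of
-- the next slot.
Fits : ℕ → Place → Set
Fits M (σ , b , r) = All (_< M) (slotDigits σ) × suc b < M × r < M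

code-injective : ∀ M {σ σ′} → All (_< M) (slotDigits σ) → All (_< M) (slotDigits σ′) →
                 code M σ ≡ code M σ′ → σ ≡ σ′
code-injective M {σ} {σ′} σ< σ′< eq = slotDigits-injective σ σ′ (proj₂ (horner-injective M {0} {0} _ _
  (trans (length-slotDigits σ) (sym (length-slotDigits σ′))) σ< σ′< eq))

close⇔meets : ∀ {M} p q → Fits M p → Fits M q → Close M (position M p) (position M q) ⇔ Meets p q
close⇔meets {M} (σ , b , r) (σ′ , b′ , r′) (σ< , b< , r<) (σ′< , b′< , r′<)
  rewrite position≡ M σ b r | position≡ M σ′ b′ r′ = mk⇔ to from
  where
  to : Close M ((code M σ * M + b) * M + r) ((code M σ′ * M + b′) * M + r′) →
       Meets (σ , b , r) (σ′ , b′ , r′)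
  to cl with close⇒ M r< r′< cl
  ... | inj₁ eq =
    let eq₁ , eq₂ = remainder-unique (<⇒≤ b<) (<⇒≤ b′<) eq in code-injective M σ< σ′< eq₁ , inj₁ eq₂
  ... | inj₂ (inj₁ (eq , r′≤)) =
    let eq₁ , eq₂ = remainder-unique (<⇒≤ b′<) b< (trans eq (sym (+-suc _ b)))
    in sym (code-injective M σ′< σ< eq₁) , inj₂ (inj₁ (eq₂ , r′≤))
  ... | inj₂ (inj₂ (eq , r≤)) =
    let eq₁ , eq₂ = remainder-unique (<⇒≤ b<) b′< (trans eq (sym (+-suc _ b′)))
    in code-injective M σ< σ′< eq₁ , inj₂ (inj₂ (eq₂ , r≤))
  from : Meets (σ , b , r) (σ′ , b′ , r′) →
         Close M ((code M σ * M + b) * M + r) ((code M σ′ * M + b′) * M + r′)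
  from (refl , inj₁ refl) = close-same M (code M σ * M + b) r< r′<
  from (refl , inj₂ (inj₁ (refl , r′≤))) rewrite +-suc (code M σ * M) b =
    close-next M (code M σ * M + b) r< r′≤
  from (refl , inj₂ (inj₂ (refl , r≤))) rewrite +-suc (code M σ * M) b′ =
    proj₂ cl , proj₁ cl
    where cl = close-next M (code M σ * M + b′) r′< r≤

close? : ∀ M → Decidable (Close M)
close? M p q = (p ≤? q + M) ×-dec (q ≤? p + M)

-- The later of the two left endpoints on a track serves as the common point.
points-meet : ∀ (I J : UnitTwoTrackInterval) →
  points I ≬ points J ⇔ (∃[ τ ] I τ ℚ.≤ J τ ℚ.+ 1ℚᵘ × J τ ℚ.≤ I τ ℚ.+ 1ℚᵘ)
points-meet I J = mk⇔
  (λ { ((τ , q) , (I≤q , q≤I) , (J≤q , q≤J)) → τ , ℚ.≤-trans I≤q q≤J , ℚ.≤-trans J≤q q≤I })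
  from
  where
  p≤p+1 : ∀ p → p ℚ.≤ p ℚ.+ 1ℚᵘ
  p≤p+1 p = ℚ.p≤p+q p 1ℚᵘ
  from : (∃[ τ ] I τ ℚ.≤ J τ ℚ.+ 1ℚᵘ × J τ ℚ.≤ I τ ℚ.+ 1ℚᵘ) → points I ≬ points J
  from (τ , I≤ , J≤) with ℚ.≤-total (I τ) (J τ)
  ... | inj₁ I≤J = (τ , J τ) , (I≤J , J≤) , (ℚ.≤-refl , p≤p+1 (J τ))
  ... | inj₂ J≤I = (τ , I τ) , (ℚ.≤-refl , p≤p+1 (I τ)) , (J≤I , I≤)

≤+1⇔ : ∀ m a b → mkℚᵘ (+ a) m ℚ.≤ mkℚᵘ (+ b) m ℚ.+ 1ℚᵘ ⇔ a ≤ b + suc m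
≤+1⇔ m a b = mk⇔
  (λ { (ℚ.*≤* le) → ℤ.drop‿+≤+ (ℤ.*-cancelʳ-≤-pos (+ a) (+ (b + suc m)) (+ suc m)
    (subst₂ (λ l q → + a ℤ.* + l ℤ.≤ q ℤ.* + suc m) (*-identityʳ (suc m)) numerator le)) })
  (λ le → ℚ.*≤* (subst₂ (λ l q → + a ℤ.* + l ℤ.≤ q ℤ.* + suc m) (sym (*-identityʳ (suc m))) (sym numerator)
    (ℤ.*-monoʳ-≤-nonNeg (+ suc m) (ℤ.+≤+ le))))
  where
  numerator : + b ℤ.* + 1 ℤ.+ + 1 ℤ.* + suc m ≡ + (b + suc m)
  numerator = cong₂ ℤ._+_ (ℤ.*-identityʳ (+ b)) (ℤ.*-identityˡ (+ suc m))

-- The constructed graph and its representation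

module Vertices (e n k : ℕ) (valid : Cell → Choice → ℕ) where
  open Construction e
  open Grid n k valid

  choiceLabels : Cell → Choice → List Label
  choiceLabels c a =
    (cand c a ∷ port row near c a ∷ port row far c a ∷ port col near c a ∷ port col far c a ∷ [])
    ++ collect e (λ m → [ link c a m ])

  cellLabels : ℕ → ℕ → List Label
  cellLabels i j =
    collect d (λ b → tail (i , j) b ∷ tail (i , j) (suc d + b) ∷ []) ++
    -- No cell precedes column 0 in its row, so there is no row check; likewise for row 0 in the
    -- next line.
    keep j (collect n λ t → [ test row (i , j) t ]) ++
    keep i (collect n λ t → [ test col (i , j) t ]) ++
    collect n λ u → collect n λ v → keep (valid (i , j) (u , v)) (choiceLabels (i , j) (u , v))

  labels : List Label
  labels = collect k λ i → collect k λ j → cellLabels i j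

  labels-present : ∀ {y} → y ∈ labels → Present y
  labels-present y∈ with ∈-collect⁻ k _ y∈
  ... | i , i<k , y∈ with ∈-collect⁻ k (cellLabels i) y∈
  ... | j , j<k , y∈ = in-cell (∈-++⁻ (collect d _) y∈)
    where
    c = i , j
    in-choice : ∀ {y a} → Chosen c a → y ∈ choiceLabels c a → Present y
    in-choice ch (here refl)                                 = ch
    in-choice ch (there (here refl))                         = ch
    in-choice ch (there (there (here refl)))                 = ch
    in-choice ch (there (there (there (here refl))))         = ch
    in-choice ch (there (there (there (there (here refl))))) = ch
    in-choice ch (there (there (there (there (there y∈))))) with ∈-collect⁻ e _ y∈
    ... | m , m<e , here refl = ch , m<e
    in-cell : _ → Present _
    in-cell (inj₁ y∈) with ∈-collect⁻ d (λ b → tail c b ∷ tail c (suc d + b) ∷ []) y∈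
    ... | b , b<d , here refl         = (i<k , j<k) , inj₁ b<d
    ... | b , b<d , there (here refl) =
      (i<k , j<k) , inj₂ (m≤m+n (suc d) b , subst (_≤ d + d) (+-suc d b) (+-monoʳ-≤ d b<d))
    in-cell (inj₂ y∈) with ∈-++⁻ (keep j (collect n λ t → [ test row c t ])) y∈
    in-cell (inj₂ _) | inj₁ y∈ with ∈-keep⁻ j y∈
    ... | j≢0 , y∈ with ∈-collect⁻ n (λ t → [ test row c t ]) y∈
    ... | t , t<n , here refl =
      ((i , pred j) , cong (i ,_) (sym (suc-pred j ⦃ ≢-nonZero j≢0 ⦄))) , (i<k , j<k) , t<n
    in-cell (inj₂ _) | inj₂ y∈ with ∈-++⁻ (keep i (collect n λ t → [ test col c t ])) y∈
    in-cell (inj₂ _) | inj₂ _ | inj₁ y∈ with ∈-keep⁻ i y∈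
    ... | i≢0 , y∈ with ∈-collect⁻ n (λ t → [ test col c t ]) y∈
    ... | t , t<n , here refl =
      ((pred i , j) , cong (_, j) (sym (suc-pred i ⦃ ≢-nonZero i≢0 ⦄))) , (i<k , j<k) , t<n
    in-cell (inj₂ _) | inj₂ _ | inj₂ y∈ with ∈-collect⁻ n _ y∈
    ... | u , u<n , y∈ with ∈-collect⁻ n (λ v → keep (valid c (u , v)) (choiceLabels c (u , v))) y∈
    ... | v , v<n , y∈ with ∈-keep⁻ (valid c (u , v)) y∈
    ... | v≢0 , y∈ = in-choice ((i<k , j<k) , (u<n , v<n) , v≢0) y∈

  present-labels : ∀ y → Present y → y ∈ labels
  present-labels = λ where
      (cand c a) ch             → in-choice ch (here refl)
      (link c a m) (ch , m<e)   → in-choice ch (∈-++⁺ʳ (cand c a ∷ _ ∷ _ ∷ _ ∷ _ ∷ [])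
                                    (∈-collect⁺ e (λ m → [ link c a m ]) m<e (here refl)))
      (port row near c a) ch    → in-choice ch (there (here refl))
      (port row far c a) ch     → in-choice ch (there (there (here refl)))
      (port col near c a) ch    → in-choice ch (there (there (there (here refl))))
      (port col far c a) ch     → in-choice ch (there (there (there (there (here refl)))))
      (tail c b) (ins , inj₁ b<d) → in-cell ins (∈-++⁺ˡ (∈-collect⁺ d (tails c) b<d (here refl)))
      (tail c b) (ins , inj₂ (d<b , b≤)) → in-cell ins (∈-++⁺ˡ (upper c d<b b≤))
      (test row (i , _) t) ((c , refl) , ins , t<n) → in-cell ins
        (∈-++⁺ʳ (collect d (tails _))
          (∈-++⁺ˡ (∈-collect⁺ n (λ t → [ test row (next row c) t ]) t<n (here refl))))
      (test col _ t) ((c , refl) , ins , t<n) → in-cell ins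
        (∈-++⁺ʳ (collect d (tails _))
          (∈-++⁺ʳ (keep (proj₂ c) (collect n λ t → [ test row (next col c) t ]))
          (∈-++⁺ˡ (∈-collect⁺ n (λ t → [ test col (next col c) t ]) t<n (here refl)))))
    where
    tails : Cell → ℕ → List Label
    tails c b = tail c b ∷ tail c (suc d + b) ∷ []
    in-cell : ∀ {y i j} → Inside (i , j) → y ∈ cellLabels i j → y ∈ labels
    in-cell {i = i} (i<k , j<k) y∈ = ∈-collect⁺ k _ i<k (∈-collect⁺ k (cellLabels i) j<k y∈)
    in-choice : ∀ {y c a} → Chosen c a → y ∈ choiceLabels c a → y ∈ labels
    in-choice {c = c@(i , j)} {u , v} (ins , (u<n , v<n) , v≢0) y∈ = in-cell ins
      (∈-++⁺ʳ (collect d (tails c)) (∈-++⁺ʳ (keep j (collect n λ t → [ test row c t ]))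
        (∈-++⁺ʳ (keep i (collect n λ t → [ test col c t ]))
          (∈-collect⁺ n _ u<n (∈-collect⁺ n (λ v → keep (valid c (u , v)) (choiceLabels c (u , v))) v<n
            (∈-keep⁺ (valid c (u , v)) v≢0 y∈))))))
    upper : ∀ c {b} → d < b → b ≤ d + d → tail c b ∈ collect d (tails c)
    upper c d<b b≤ with m≤n⇒∃[o]m+o≡n d<b
    ... | o , refl = ∈-collect⁺ d (tails c)
      (+-cancelˡ-≤ d (suc o) d (≤-trans (≤-reflexive (+-suc d o)) b≤)) (there (here refl))

  -- Exceeds every digit: blocks up to `d + d` with one to spare, ranks and values up to `n`, grid
  -- indices up to `k`, and slot kinds up to 3.
  M : ℕ
  M = 2 + (d + d) + n + k

  private
    blocks<M : ∀ {b} → b ≤ d + d → suc b < M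
    blocks<M b≤ = ≤-trans (s≤s (s≤s b≤)) (≤-trans (m≤m+n (2 + (d + d)) n) (m≤m+n _ k))

    n<M : ∀ {u} → u ≤ n → u < M
    n<M u≤n = ≤-trans (s≤s (≤-trans u≤n (≤-trans (m≤n+m n (suc (d + d))) (m≤m+n _ k)))) ≤-refl

    k<M : ∀ {i} → i ≤ k → i < M
    k<M i≤k = s≤s (≤-trans i≤k (m≤n+m k (suc (d + d) + n)))

    digit<M : ∀ {c} → c < 4 → c < M
    digit<M c<4 = ≤-trans c<4 (s≤s (s≤s (s≤s (s≤s z≤n))))

    check-fits : ∀ δ {i j} → i ≤ k → j ≤ k → All (_< M) (slotDigits (checkSlot δ (i , j)))
    check-fits row i≤ j≤ = digit<M (s≤s (s≤s z≤n)) ∷ k<M i≤ ∷ k<M j≤ ∷ z<s ∷ z<s ∷ []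
    check-fits col i≤ j≤ = digit<M (s≤s (s≤s (s≤s z≤n))) ∷ k<M i≤ ∷ k<M j≤ ∷ z<s ∷ z<s ∷ []

    cell-fits : ∀ {c} → Inside c → All (_< M) (slotDigits (cellSlot c))
    cell-fits (i<k , j<k) = z<s ∷ k<M (<⇒≤ i<k) ∷ k<M (<⇒≤ j<k) ∷ z<s ∷ z<s ∷ []

    choice-fits : ∀ {c a} → Chosen c a → All (_< M) (slotDigits (choiceSlot c a))
    choice-fits ((i<k , j<k) , (u<n , v<n) , _) =
      digit<M ≤-refl ∷ k<M (<⇒≤ i<k) ∷ k<M (<⇒≤ j<k) ∷ n<M (<⇒≤ u<n) ∷ n<M (<⇒≤ v<n) ∷ []

    socket-fits : ∀ σ δ {c} → Inside c → All (_< M) (slotDigits (checkSlot δ (socket σ δ c)))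
    socket-fits near row (i<k , j<k) = check-fits row (<⇒≤ i<k) j<k
    socket-fits near col (i<k , j<k) = check-fits col i<k (<⇒≤ j<k)
    socket-fits far  δ   (i<k , j<k) = check-fits δ (<⇒≤ i<k) (<⇒≤ j<k)

    rank-fits : ∀ σ δ {c a} → Chosen c a → socketRank σ δ a < M
    rank-fits near row (_ , (u<n , v<n) , _) = n<M (<⇒≤ u<n)
    rank-fits near col (_ , (u<n , v<n) , _) = n<M (<⇒≤ v<n)
    rank-fits far  row (_ , (u<n , v<n) , _) = n<M u<n
    rank-fits far  col (_ , (u<n , v<n) , _) = n<M v<n

    link-fits : ∀ {c a} m → m < e → Chosen c a → Fits M (choiceSlot c a , suc m , 0)
    link-fits m m<e ch =
      choice-fits ch , blocks<M (≤-trans (≤-trans m<e (m≤n+m e 2)) (m≤m+n d d)) , z<s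

    tail-fits : ∀ {c b} → Inside c → b < d ⊎ (d < b × b ≤ d + d) → Fits M (cellSlot c , b , 0)
    tail-fits ins (inj₁ b<d)      = cell-fits ins , blocks<M (≤-trans (<⇒≤ b<d) (m≤m+n d d)) , z<s
    tail-fits ins (inj₂ (_ , b≤)) = cell-fits ins , blocks<M b≤ , z<s

    test-fits : ∀ δ {c t} → Inside c → t < n → Fits M (checkSlot δ c , 1 , t)
    test-fits δ (i<k , j<k) t<n =
      check-fits δ (<⇒≤ i<k) (<⇒≤ j<k) , blocks<M (s≤s z≤n) , n<M (<⇒≤ t<n)

  fits : ∀ y τ → Present y → Fits M (place τ y)
  fits (cand c a) track₁ (ins , _)      = cell-fits ins , blocks<M (m≤m+n d d) , z<s
  fits (cand c a) track₂ ch             = choice-fits ch , blocks<M z≤n , z<s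
  fits (link c a m) track₁ (ch , m<e)   = link-fits m m<e ch
  fits (link c a m) track₂ (ch , m<e)   = link-fits m m<e ch
  fits (port δ near c a) track₁ ch@(ins , _) = socket-fits near δ ins , blocks<M z≤n , rank-fits near δ ch
  fits (port δ far c a) track₁ ch@(ins , _) =
    socket-fits far δ ins , blocks<M (s≤s (s≤s z≤n)) , rank-fits far δ ch
  fits (port δ σ c a) track₂ ch         =
    choice-fits ch , blocks<M (≤-trans (n≤1+n (suc e)) (m≤m+n d d)) , z<s
  fits (tail c b) track₁ (ins , side)   = tail-fits ins side
  fits (tail c b) track₂ (ins , side)   = tail-fits ins side
  fits (test δ c t) track₁ (_ , ins , t<n) = test-fits δ ins t<n
  fits (test δ c t) track₂ (_ , ins , t<n) = test-fits δ ins t<n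

  N : ℕ
  N = length labels

  label : Fin N → Label
  label = lookup labels

  label-present : ∀ u → Present (label u)
  label-present u = labels-present (∈-lookup u)

  find : ∀ {y} → Present y → ∃[ u ] label u ≡ y
  find {y} p = Any.index (present-labels y p) , sym (lookup-index (present-labels y p))

  start : Track → Fin N → ℕ
  start τ u = position M (place τ (label u))

  CloseOn : Track → Fin N → Fin N → Set
  CloseOn τ u v = Close M (start τ u) (start τ v)

  graph : Graph N
  graph = record
    { _~_      = λ u v → u ≢ v × (CloseOn track₁ u v ⊎ CloseOn track₂ u v)
    ; ~-sym    = λ where
        (u≢v , inj₁ (p , q)) → u≢v ∘ sym , inj₁ (q , p)
        (u≢v , inj₂ (p , q)) → u≢v ∘ sym , inj₂ (q , p)
    ; ~-irrefl = λ u≡v (u≢v , _) → u≢v u≡v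
    }
  open Graph graph using (_~_)

  _~?_ : Decidable _~_
  u ~? v = ¬? (u Fin.≟ v) ×-dec
    (close? M (start track₁ u) (start track₁ v) ⊎-dec close? M (start track₂ u) (start track₂ v))

  closeOn⇔ : ∀ τ u v → CloseOn τ u v ⇔ Meets (place τ (label u)) (place τ (label v))
  closeOn⇔ τ u v = close⇔meets _ _ (fits (label u) τ (label-present u)) (fits (label v) τ (label-present v))

  ~⇔adjacent : ∀ u v → (u ~ v) ⇔ (u ≢ v × Adjacent (label u) (label v))
  ~⇔adjacent u v = mk⇔
    (λ where
      (u≢v , inj₁ c) → u≢v , track₁ , Equivalence.to (closeOn⇔ track₁ u v) c
      (u≢v , inj₂ c) → u≢v , track₂ , Equivalence.to (closeOn⇔ track₂ u v) c)
    (λ where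
      (u≢v , track₁ , m) → u≢v , inj₁ (Equivalence.from (closeOn⇔ track₁ u v) m)
      (u≢v , track₂ , m) → u≢v , inj₂ (Equivalence.from (closeOn⇔ track₂ u v) m))

  -- `mkℚᵘ` takes the denominator minus one, here `M` minus one; dividing by `M` turns the length
  -- `M` into 1.
  family : Fin N → UnitTwoTrackInterval
  family u τ = mkℚᵘ (+ start τ u) (suc (d + d) + n + k)

  represents : IsIntersectionGraphOf graph (λ u → points (family u))
  represents u v = mk⇔
    (λ where
      (u≢v , inj₁ c) → u≢v , meet (track₁ , to-rational track₁ c)
      (u≢v , inj₂ c) → u≢v , meet (track₂ , to-rational track₂ c))
    (λ (u≢v , m) → u≢v , from-rational (Equivalence.to (points-meet (family u) (family v)) m))
    where
    OverlapOn : Track → Set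
    OverlapOn τ = family u τ ℚ.≤ family v τ ℚ.+ 1ℚᵘ × family v τ ℚ.≤ family u τ ℚ.+ 1ℚᵘ
    meet : (∃[ τ ] OverlapOn τ) → points (family u) ≬ points (family v)
    meet = Equivalence.from (points-meet (family u) (family v))
    to-rational : ∀ τ → CloseOn τ u v → OverlapOn τ
    to-rational τ (p , q) =
      Equivalence.from (≤+1⇔ _ _ (start τ v)) p , Equivalence.from (≤+1⇔ _ _ (start τ u)) q
    from-overlap : ∀ τ → OverlapOn τ → CloseOn τ u v
    from-overlap τ (p , q) =
      Equivalence.to (≤+1⇔ _ _ (start τ v)) p , Equivalence.to (≤+1⇔ _ _ (start τ u)) q
    from-rational : (∃[ τ ] OverlapOn τ) → CloseOn track₁ u v ⊎ CloseOn track₂ u v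
    from-rational (track₁ , o) = inj₁ (from-overlap track₁ o)
    from-rational (track₂ , o) = inj₂ (from-overlap track₂ o)

  code⇔solution : (∀ {i u v} → valid (i , i) (u , v) ≢ 0 → u ≡ v) →
    Solution ⇔ (∃[ S ] IsPerfectCode (power graph d) S × ∣ S ∣ ≡ k * k)
  code⇔solution diagonal = mk⇔
    (solution⇒code graph label ~⇔adjacent label-present find)
    (λ (S , perfect , size) → code⇒solution graph label ~⇔adjacent label-present find perfect size diagonal)

-- Cliques as solutions of the grid

nth-++ˡ : ∀ xs ys {a} → a < length xs → nth (xs ++ ys) a ≡ nth xs a
nth-++ˡ (x ∷ xs) ys {zero}  a< = refl
nth-++ˡ (x ∷ xs) ys {suc a} a< = nth-++ˡ xs ys (≤-pred a<)

nth-++ʳ : ∀ xs ys a → nth (xs ++ ys) (length xs + a) ≡ nth ys a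
nth-++ʳ []       ys a = refl
nth-++ʳ (x ∷ xs) ys a = nth-++ʳ xs ys a

nth-map-tabulate : ∀ {A : Set} {n} (h : A → ℕ) (g : Fin n → A) v → nth (map h (tabulate g)) (toℕ v) ≡ h (g v)
nth-map-tabulate h g zero    = refl
nth-map-tabulate h g (suc v) = nth-map-tabulate h (g ∘ suc) v

nth-cartesianProductWith : ∀ {m n} {A : Set} (f : A → Fin n → ℕ) (g : Fin m → A) u (v : Fin n) →
  nth (cartesianProductWith f (tabulate g) (allFin n)) (toℕ u * n + toℕ v) ≡ f (g u) v
nth-cartesianProductWith {n = n} f g zero v = trans
  (nth-++ˡ (map (f (g zero)) (allFin n)) _
    (subst (toℕ v <_) (sym (trans (length-map (f (g zero)) (allFin n)) (length-tabulate id))) (Fin.toℕ<n v)))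
  (nth-map-tabulate (f (g zero)) id v)
nth-cartesianProductWith {n = n} f g (suc u) v = trans
  (cong (nth (row₀ ++ rest)) (trans (+-assoc n (toℕ u * n) (toℕ v))
    (cong (_+ (toℕ u * n + toℕ v))
      (sym (trans (length-map (f (g zero)) (allFin n)) (length-tabulate {n = n} id))))))
  (trans (nth-++ʳ row₀ rest (toℕ u * n + toℕ v)) (nth-cartesianProductWith f (g ∘ suc) u v))
  where
  row₀ = map (f (g zero)) (allFin n)
  rest = cartesianProductWith f (tabulate (g ∘ suc)) (allFin n)

difference : ℕ → ℕ → ℕ
difference m n = (m ∸ n) + (n ∸ m)

difference-refl : ∀ n → difference n n ≡ 0
difference-refl n = cong₂ _+_ (n∸n≡0 n) (n∸n≡0 n)

difference≡0 : ∀ m n → difference m n ≡ 0 → m ≡ n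
difference≡0 m n eq = ≤-antisym (m∸n≡0⇒m≤n (m+n≡0⇒m≡0 (m ∸ n) eq)) (m∸n≡0⇒m≤n (m+n≡0⇒n≡0 (m ∸ n) eq))

-- Nonzero iff u = v in case i = j, and iff the matrix entry (u , v) of the encoded
-- clique instance x is nonzero in case i ≠ j; arithmetic, as programs must compute it.
validFor : Word → ℕ → Cell → Choice → ℕ
validFor x n (i , j) (u , v) =
  (((1 ∸ difference i j) + (1 ∸ difference u v)) ∸ 1) +
  ((1 ∸ (1 ∸ nth x (2 + (u * n + v)))) ∸ (1 ∸ difference i j))

module _ (x : Word) (n : ℕ) where

  edge : ℕ → ℕ → ℕ
  edge u v = nth x (2 + (u * n + v))

  validFor-diagonal : ∀ {i u v} → validFor x n (i , i) (u , v) ≢ 0 → u ≡ v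
  validFor-diagonal {i} {u} {v} rewrite difference-refl i with difference u v in eq | edge u v
  ... | zero  | _     = λ _ → difference≡0 u v eq
  ... | suc o | zero  rewrite 0∸n≡0 o = λ ≢0 → ⊥-elim (≢0 refl)
  ... | suc o | suc w rewrite 0∸n≡0 o | 0∸n≡0 w = λ ≢0 → ⊥-elim (≢0 refl)

  diagonal-validFor : ∀ i u → validFor x n (i , i) (u , u) ≢ 0
  diagonal-validFor i u rewrite difference-refl i | difference-refl u = λ ()

  validFor-edge : ∀ {i j u v} → i ≢ j → validFor x n (i , j) (u , v) ≢ 0 → edge u v ≢ 0
  validFor-edge {i} {j} {u} {v} i≢j ≢0 edge≡0 with difference i j in eq | difference u v
  ... | zero  | _     = i≢j (difference≡0 i j eq)
  ... | suc o | zero  rewrite edge≡0 | 0∸n≡0 o = ≢0 refl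
  ... | suc o | suc p rewrite edge≡0 | 0∸n≡0 o | 0∸n≡0 p = ≢0 refl

  edge-validFor : ∀ {i j u v} → i ≢ j → edge u v ≢ 0 → validFor x n (i , j) (u , v) ≢ 0
  edge-validFor {i} {j} {u} {v} i≢j edge≢0 with difference i j in eq | edge u v
  ... | zero  | _     = ⊥-elim (i≢j (difference≡0 i j eq))
  ... | suc o | zero  = ⊥-elim (edge≢0 refl)
  ... | suc o | suc w rewrite 0∸n≡0 o | 0∸n≡0 w = λ eq′ → 1+n≢0 (m+n≡0⇒n≡0 _ eq′)

module _ (I : CliqueInstance) where
  open CliqueInstance I
  open Graph graph

  word : Word
  word = ParameterizedProblem.encode Clique I

  valid : Cell → Choice → ℕ
  valid = validFor word order

  edge-word : ∀ u v → edge word order (toℕ u) (toℕ v) ≡ encodeBool (does (u ~? v))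
  edge-word = nth-cartesianProductWith (λ u v → encodeBool (does (u ~? v))) id

  edge⇒~ : ∀ {u v} → edge word order (toℕ u) (toℕ v) ≢ 0 → u ~ v
  edge⇒~ {u} {v} ≢0 with u ~? v | edge-word u v
  ... | yes p | _  = p
  ... | no _  | eq = ⊥-elim (≢0 eq)

  ~⇒edge : ∀ {u v} → u ~ v → edge word order (toℕ u) (toℕ v) ≢ 0
  ~⇒edge {u} {v} p ≡0 with u ~? v | edge-word u v
  ... | yes _ | eq = 1+n≢0 (trans (sym eq) ≡0)
  ... | no ¬p | _  = ¬p p

  module _ (e : ℕ) where
    open Construction.Grid e order k valid using (Solution)

    clique⇒solution : (∃[ S ] IsClique graph S × ∣ S ∣ ≡ k) → Solution
    clique⇒solution (S , clique , size) = (λ i → toℕ (f i)) , (λ i → Fin.toℕ<n (f i)) , f-valid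
      where
      f : Fin k → Fin order
      f i = enumerate S (subst Fin (sym size) i)
      f-injective : ∀ {i j} → f i ≡ f j → i ≡ j
      f-injective eq = subst-injective (sym size) (enumerate-injective S eq)
      f-valid : ∀ i j → valid (toℕ i , toℕ j) (toℕ (f i) , toℕ (f j)) ≢ 0
      f-valid i j with i Fin.≟ j
      ... | yes refl = diagonal-validFor word order (toℕ i) (toℕ (f i))
      ... | no i≢j   = edge-validFor word order {toℕ i} {toℕ j} {toℕ (f i)} {toℕ (f j)}
        (i≢j ∘ Fin.toℕ-injective)
        (~⇒edge (clique _ _ (enumerate-∈ S _) (enumerate-∈ S _) (i≢j ∘ f-injective)))

    -- Cells off the diagonal demand edges, and a vertex is not adjacent to itself, so the `k`
    -- values are automatically distinct.
    solution⇒clique : Solution → ∃[ S ] IsClique graph S × ∣ S ∣ ≡ k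
    solution⇒clique (F , F<n , F-valid) = image f f-injective , clique , ∣image∣ f f-injective
      where
      f : Fin k → Fin order
      f i = fromℕ< (F<n i)
      f-adjacent : ∀ {i j} → i ≢ j → f i ~ f j
      f-adjacent {i} {j} i≢j = edge⇒~ (subst₂ (λ u v → edge word order u v ≢ 0)
        (sym (Fin.toℕ-fromℕ< (F<n i))) (sym (Fin.toℕ-fromℕ< (F<n j)))
        (validFor-edge word order {toℕ i} {toℕ j} {F i} {F j} (i≢j ∘ Fin.toℕ-injective) (F-valid i j)))
      f-injective : Injective _≡_ _≡_ f
      f-injective {i} {j} eq = decidable-stable (i Fin.≟ j) λ i≢j → ~-irrefl eq (f-adjacent i≢j)
      clique : IsClique graph (image f f-injective)
      clique u v u∈ v∈ u≢v with image-∈ f f-injective u∈ | image-∈ f f-injective v∈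
      ... | i , refl | j , refl = f-adjacent (u≢v ∘ cong f)

-- The reduction as a program

collect-front : ∀ {A : Set} n (f : ℕ → List A) → collect (suc n) f ≡ f 0 ++ collect n (f ∘ suc)
collect-front zero    f = sym (++-identityʳ (f 0))
collect-front (suc n) f = trans (cong (_++ f (suc n)) (collect-front n f))
  (++-assoc (f 0) (collect n (f ∘ suc)) (f (suc n)))

concatMap-tabulate : ∀ {A B : Set} {n} (F : A → List B) (g : Fin n → A) (f : ℕ → List B) →
                     (∀ u → F (g u) ≡ f (toℕ u)) → concatMap F (tabulate g) ≡ collect n f
concatMap-tabulate {n = zero}  F g f eq = refl
concatMap-tabulate {n = suc n} F g f eq = trans
  (cong₂ _++_ (eq zero) (concatMap-tabulate F (g ∘ suc) (f ∘ suc) (eq ∘ suc)))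
  (sym (collect-front n f))

map≡concatMap : ∀ {A B : Set} (f : A → B) xs → map f xs ≡ concatMap (λ y → [ f y ]) xs
map≡concatMap f []       = refl
map≡concatMap f (y ∷ xs) = cong (f y ∷_) (map≡concatMap f xs)

cartesianProductWith≡concatMap : ∀ {A B C : Set} (f : A → B → C) xs ys →
  cartesianProductWith f xs ys ≡ concatMap (λ x → map (f x) ys) xs
cartesianProductWith≡concatMap f []       ys = refl
cartesianProductWith≡concatMap f (x ∷ xs) ys = cong (map (f x) ys ++_) (cartesianProductWith≡concatMap f xs ys)

cartesianProductWith-collect : ∀ {n} (f : Fin n → Fin n → ℕ) (h : ℕ → ℕ → ℕ) →
  (∀ u v → f u v ≡ h (toℕ u) (toℕ v)) →
  cartesianProductWith f (allFin n) (allFin n) ≡ collect n λ a → collect n λ b → [ h a b ]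
cartesianProductWith-collect {n} f h eq = trans (cartesianProductWith≡concatMap f (allFin n) (allFin n))
  (concatMap-tabulate _ id _ λ u → trans (map≡concatMap (f u) (allFin n))
    (concatMap-tabulate _ id _ λ v → cong [_] (eq u v)))

nth-pairs : ∀ {A : Set} (f g : A → ℕ) xs u →
  let w = concatMap (λ y → f y ∷ g y ∷ []) xs in
  nth w (toℕ u + toℕ u) ≡ f (lookup xs u) × nth w (1 + (toℕ u + toℕ u)) ≡ g (lookup xs u)
nth-pairs f g (x ∷ xs) zero = refl , refl
nth-pairs f g (x ∷ xs) (suc u) rewrite +-suc (toℕ u) (toℕ u) = nth-pairs f g xs u

length-pairs : ∀ {A : Set} (f g : A → ℕ) xs →
  length (concatMap (λ y → f y ∷ g y ∷ []) xs) ≡ length xs + length xs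
length-pairs f g []       = refl
length-pairs f g (x ∷ xs) = cong suc (trans (cong suc (length-pairs f g xs))
  (sym (+-suc (length xs) (length xs))))

flag : ∀ {P : Set} (p? : Dec P) {a} → (P → a ≡ 0) → (a ≡ 0 → P) → encodeBool (does p?) ≡ 1 ∸ a
flag (yes p) to from rewrite to p = refl
flag (no ¬p) {zero}  to from = ⊥-elim (¬p (from refl))
flag (no ¬p) {suc a} to from = sym (0∸n≡0 a)

flags : ∀ {P Q R : Set} (p? : Dec P) (q? : Dec Q) (r? : Dec R) {a b c} →
  (P → a ≡ 0) → (a ≡ 0 → P) → (Q → b ≡ 0) → (b ≡ 0 → Q) → (R → c ≡ 0) → (c ≡ 0 → R) →
  encodeBool (does (¬? p? ×-dec (q? ⊎-dec r?))) ≡ (1 ∸ (1 ∸ ((1 ∸ b) + (1 ∸ c)))) ∸ (1 ∸ a)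
flags p? q? r? p⇒ p⇐ q⇒ q⇐ r⇒ r⇐
  rewrite sym (flag p? p⇒ p⇐) | sym (flag q? q⇒ q⇐) | sym (flag r? r⇒ r⇐) =
  table (does p?) (does q?) (does r?)
  where
  table : ∀ p q r → encodeBool (not p ∧ (q ∨ r)) ≡
    (1 ∸ (1 ∸ (encodeBool q + encodeBool r))) ∸ encodeBool p
  table true  false false = refl
  table true  false true  = refl
  table true  true  false = refl
  table true  true  true  = refl
  table false false false = refl
  table false false true  = refl
  table false true  false = refl
  table false true  true  = refl

bounds : ℕ → ℕ → ℕ → ℕ
bounds n k = ((λ _ → 0) [ 0 ↦ n ]) [ 1 ↦ k ]

module Stages (e : ℕ) where
  open Construction e using (d; place)

  modulus : ∀ {s m} {_ : T (0 <ᵇ m)} {_ : T (1 <ᵇ m)} → Term s m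
  modulus {_} {_} {p} {q} = lit (2 + (d + d)) ⊕ var 0 {p} ⊕ var 1 {q}

  putHorner : ∀ {m} {_ : T (0 <ᵇ m)} {_ : T (1 <ᵇ m)} {_ : T (m <ᵇ 13)} {_ : T (m <ᵇ suc m)} →
              List (Term array m) → Gen array m
  putHorner {m} {p} {q} {r} {s} ts =
    letHorner {_} {m} {r} (modulus {_} {_} {p} {q}) ts (put {_} {suc m} {r} (var {_} {suc m} m {s}))

  vertex : ∀ {m} {_ : T (0 <ᵇ m)} {_ : T (1 <ᵇ m)} {_ : T (m <ᵇ 13)} {_ : T (m <ᵇ suc m)} →
           List (Term array m) → List (Term array m) → Gen array m
  vertex {m} {p} {q} {r} {s} ts us = putHorner {m} {p} {q} {r} {s} ts ⊙ putHorner {m} {p} {q} {r} {s} us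

  differenceTerm : ∀ {s m} → Term s m → Term s m → Term s m
  differenceTerm t u = (t ⊖ u) ⊕ (u ⊖ t)

  validTerm : ∀ {s} → Term s 7
  validTerm =
    (((lit 1 ⊖ differenceTerm (var 2) (var 3)) ⊕ (lit 1 ⊖ differenceTerm (var 4) (var 5))) ⊖ lit 1) ⊕
    ((lit 1 ⊖ (lit 1 ⊖ input (lit 2 ⊕ var 6))) ⊖ (lit 1 ⊖ differenceTerm (var 2) (var 3)))

  -- The variables are n, k, i, j, u, v, u * n + v in this order.
  choiceGen : Gen array 7
  choiceGen =
    vertex (lit 0 ∷ i ∷ j ∷ lit 0 ∷ lit 0 ∷ lit d ∷ lit 0 ∷ [])
           (lit 3 ∷ i ∷ j ∷ u ∷ v ∷ lit 0 ∷ lit 0 ∷ []) ⊙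
    vertex (lit 1 ∷ i ∷ lit 1 ⊕ j ∷ lit 0 ∷ lit 0 ∷ lit 0 ∷ u ∷ []) outlet ⊙
    vertex (lit 1 ∷ i ∷ j ∷ lit 0 ∷ lit 0 ∷ lit 2 ∷ lit 1 ⊕ u ∷ []) outlet ⊙
    vertex (lit 2 ∷ lit 1 ⊕ i ∷ j ∷ lit 0 ∷ lit 0 ∷ lit 0 ∷ v ∷ []) outlet ⊙
    vertex (lit 2 ∷ i ∷ j ∷ lit 0 ∷ lit 0 ∷ lit 2 ∷ lit 1 ⊕ v ∷ []) outlet ⊙
    for (lit e) (vertex inner inner)
    where
    i j u v : Term array 7
    i = var 2
    j = var 3
    u = var 4
    v = var 5
    outlet : List (Term array 7)
    outlet = lit 3 ∷ i ∷ j ∷ u ∷ v ∷ lit (suc e) ∷ lit 0 ∷ []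
    inner : List (Term array 8)
    inner = lit 3 ∷ var 2 ∷ var 3 ∷ var 4 ∷ var 5 ∷ lit 1 ⊕ var 7 ∷ lit 0 ∷ []

  cellGen : Gen array 4
  cellGen =
    for (lit d) (vertex (tailDigits (var 4)) (tailDigits (var 4)) ⊙
                 vertex (tailDigits (lit (suc d) ⊕ var 4)) (tailDigits (lit (suc d) ⊕ var 4))) ⊙
    when (var 3) (for (var 0) (vertex (testDigits 1) (testDigits 1))) ⊙
    when (var 2) (for (var 0) (vertex (testDigits 2) (testDigits 2))) ⊙
    -- The two-digit number `u v` in base `n` is `u * n + v`, the index of the matrix entry.
    for (var 0) (for (var 0) (letHorner (var 0) (var 4 ∷ var 5 ∷ []) (when validTerm choiceGen)))
    where
    tailDigits : Term array 5 → List (Term array 5)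
    tailDigits b = lit 0 ∷ var 2 ∷ var 3 ∷ lit 0 ∷ lit 0 ∷ b ∷ lit 0 ∷ []
    testDigits : ℕ → List (Term array 5)
    testDigits c = lit c ∷ var 2 ∷ var 3 ∷ lit 0 ∷ lit 0 ∷ lit 1 ∷ var 4 ∷ []

  positionGen : Gen array 2
  positionGen = for (var 1) (for (var 1) cellGen)

  -- Both truncated differences vanish iff the starting points are `Close`.
  apartTerm : ∀ {m} {_ : T (0 <ᵇ m)} {_ : T (1 <ᵇ m)} → Term tape m → Term tape m → Term tape m
  apartTerm {_} {p} {q} t u = (t ⊖ (u ⊕ modulus {_} {_} {p} {q})) ⊕ (u ⊖ (t ⊕ modulus {_} {_} {p} {q}))

  -- Subtracting from 1 negates a flag: doing it twice caps the number of tracks on which the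
  -- vertices meet at 1, and the last term clears the diagonal.
  bitTerm : Term tape 5
  bitTerm =
    (lit 1 ⊖ (lit 1 ⊖ ((lit 1 ⊖ apartTerm (stored (var 3 ⊕ var 3)) (stored (var 4 ⊕ var 4))) ⊕
                       (lit 1 ⊖ apartTerm (stored (lit 1 ⊕ (var 3 ⊕ var 3))) (stored (lit 1 ⊕ (var 4 ⊕ var 4)))))))
    ⊖ (lit 1 ⊖ differenceTerm (var 3) (var 4))

  -- The variables are n, k and the number of vertices.
  outputGen : Gen tape 3
  outputGen =
    put (var 2) ⊙ letHorner (var 1) (var 1 ∷ lit 0 ∷ []) (put (var 3)) ⊙
    for (var 2) (for (var 2) (put bitTerm)) ⊙
    for (var 2) (put (lit 0) ⊙ put (stored (var 3 ⊕ var 3)) ⊙ put modulus ⊙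
                 put (lit 0) ⊙ put (stored (lit 1 ⊕ (var 3 ⊕ var 3))) ⊙ put modulus)

  module _ (x : Word) (n k : ℕ) where
    open Vertices e n k (validFor x n)

    places : Label → Word
    places y = position M (place track₁ y) ∷ position M (place track₂ y) ∷ []

    module _ (α : ℕ → ℕ) where

      -- The digits written out in the program are those of `slotDigits` and `place`, so all but the
      -- loop holds by computation.
      choiceGen-correct : ∀ i j u v c →
        ⟦_⟧ x α choiceGen (bounds n k [ 2 ↦ i ] [ 3 ↦ j ] [ 4 ↦ u ] [ 5 ↦ v ] [ 6 ↦ c ]) ≡
        concatMap places (choiceLabels (i , j) (u , v))
      choiceGen-correct i j u v c = cong (concatMap places
        (cand (i , j) (u , v) ∷ port row near (i , j) (u , v) ∷ port row far (i , j) (u , v) ∷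
         port col near (i , j) (u , v) ∷ port col far (i , j) (u , v) ∷ []) ++_)
        (sym (concatMap-collect places e _))

      cellGen-correct : ∀ i j →
        ⟦_⟧ x α cellGen (bounds n k [ 2 ↦ i ] [ 3 ↦ j ]) ≡ concatMap places (cellLabels i j)
      cellGen-correct i j = sym (trans (concatMap-++ places (collect d _) _) (cong₂ _++_
        (concatMap-collect places d _)
        (trans (concatMap-++ places (keep j _) _) (cong₂ _++_
          (trans (concatMap-keep places j _) (cong (keep j) (concatMap-collect places n _)))
          (trans (concatMap-++ places (keep i _) _) (cong₂ _++_
            (trans (concatMap-keep places i _) (cong (keep i) (concatMap-collect places n _)))
            (trans (concatMap-collect places n _) (collect-cong n λ u →
              trans (concatMap-collect places n _) (collect-cong n λ v →
                trans (concatMap-keep places (validFor x n (i , j) (u , v)) _)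
                  (cong (keep (validFor x n (i , j) (u , v))) (sym (choiceGen-correct i j u v (u * n + v)))))))))))))

      positionGen-correct : ⟦_⟧ x α positionGen (bounds n k) ≡ concatMap places labels
      positionGen-correct = sym (trans (concatMap-collect places k _) (collect-cong k λ i →
        trans (concatMap-collect places k _) (collect-cong k λ j → sym (cellGen-correct i j))))

    stored-places : ℕ → ℕ
    stored-places = nth (concatMap places labels)

    stored-at : ∀ u → stored-places (toℕ u + toℕ u) ≡ start track₁ u ×
                      stored-places (1 + (toℕ u + toℕ u)) ≡ start track₂ u
    stored-at = nth-pairs (λ y → position M (place track₁ y)) (λ y → position M (place track₂ y)) labels

    apart : ℕ → ℕ → ℕ
    apart p q = (p ∸ (q + M)) + (q ∸ (p + M))

    bit : ℕ → ℕ → ℕ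
    bit a b = (1 ∸ (1 ∸ ((1 ∸ apart (ω (a + a)) (ω (b + b))) +
                         (1 ∸ apart (ω (1 + (a + a))) (ω (1 + (b + b)))))))
              ∸ (1 ∸ difference a b)
      where
      ω : ℕ → ℕ
      ω = stored-places

    apart⇒close : ∀ {p q} → apart p q ≡ 0 → Close M p q
    apart⇒close {p} {q} eq = m∸n≡0⇒m≤n (m+n≡0⇒m≡0 _ eq) , m∸n≡0⇒m≤n (m+n≡0⇒n≡0 (p ∸ (q + M)) eq)

    close⇒apart : ∀ {p q} → Close M p q → apart p q ≡ 0
    close⇒apart (p≤ , q≤) = cong₂ _+_ (m≤n⇒m∸n≡0 p≤) (m≤n⇒m∸n≡0 q≤)

    bit-correct : ∀ u v → encodeBool (does (u ~? v)) ≡ bit (toℕ u) (toℕ v)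
    bit-correct u v = trans
      (flags (u Fin.≟ v)
        (close? M (start track₁ u) (start track₁ v)) (close? M (start track₂ u) (start track₂ v))
        (λ { refl → difference-refl (toℕ u) })
        (λ eq → Fin.toℕ-injective (difference≡0 (toℕ u) (toℕ v) eq))
        close⇒apart apart⇒close close⇒apart apart⇒close)
      (sym (cong₂ (λ a b → (1 ∸ (1 ∸ ((1 ∸ a) + (1 ∸ b)))) ∸ (1 ∸ difference (toℕ u) (toℕ v)))
        (cong₂ apart (proj₁ (stored-at u)) (proj₁ (stored-at v)))
        (cong₂ apart (proj₂ (stored-at u)) (proj₂ (stored-at v)))))

    encodeMatrix≡ : encodeMatrix _~?_ ≡ collect N λ a → collect N λ b → [ bit a b ]
    encodeMatrix≡ = cartesianProductWith-collect _ bit bit-correct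

    encodeIntervals≡ : concatMap (λ u → encodeInterval (family u)) (allFin N) ≡
      collect N λ a → 0 ∷ stored-places (a + a) ∷ M ∷ 0 ∷ stored-places (1 + (a + a)) ∷ M ∷ []
    encodeIntervals≡ = concatMap-tabulate _ id _ λ u → sym
      (cong₂ (λ a b → 0 ∷ a ∷ M ∷ 0 ∷ b ∷ M ∷ []) (proj₁ (stored-at u)) (proj₂ (stored-at u)))

    -- `k * k` is computed as the two-digit number `k 0` in base `k`, whence the trailing `+ 0`.
    outputGen-correct : ⟦_⟧ x stored-places outputGen (bounds n k [ 2 ↦ N ]) ≡
      N ∷ k * k ∷ encodeMatrix _~?_ ++ concatMap (λ u → encodeInterval (family u)) (allFin N)
    outputGen-correct = cong (N ∷_)
      (cong₂ _∷_ (+-identityʳ (k * k)) (sym (cong₂ _++_ encodeMatrix≡ encodeIntervals≡)))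

-- Computing polynomials, and the total running time

horner-power : ∀ b c E → horner b c (replicate E 0) ≡ c * b ^ E
horner-power b c zero    = sym (*-identityʳ c)
horner-power b c (suc E) = trans (horner-power b (c * b + 0) E)
  (trans (cong (_* b ^ E) (+-identityʳ (c * b))) (*-assoc c b (b ^ E)))

-- The digit `c` followed by `E` zeros, read in base `a + k`; a single `letHorner` suffices.
computable-polynomial : ∀ a c E → Computable (λ k → c * (a + k) ^ E)
computable-polynomial a c E = (mem[ lit 3 ]≔ input (lit 0) ⨾ compile gen) , run
  where
  gen : Gen tape 1
  gen = letHorner (lit a ⊕ var 0) (lit c ∷ replicate E (lit 0)) (put (var 1))
  run : ∀ k → ∃[ t ] (mem[ lit 3 ]≔ input (lit 0) ⨾ compile gen) maps [ k ] to [ c * (a + k) ^ E ] in-steps t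
  run k with compile-reaches [ k ] {ρ = λ _ → k} {w = []} (a + k) gen (≤-refl , tt)
               (holds {s = ⟨ (λ _ → 0) [ 3 ↦ k ] , [] ⟩} (λ { (s≤s z≤n) → refl }) ((λ _ → refl {x = 0}) , refl))
  ... | s , _ , steps , _ , holds _ (_ , out) = _ , s , seq assign steps , trans out (cong [_] (trans
    (cong (horner (a + k) c) (map-replicate _ E (lit 0))) (horner-power (a + k) c E)))

-- The array holds two numbers per vertex, so half its length is the number of vertices. Register 5
-- is that of variable 2, where `outputGen` expects it.
halve : Cmd
halve = mem[ lit 5 ]≔ lit 0 ⨾
  whileNonZero mem (lit 0) ⊖ (mem (lit 5) ⊕ mem (lit 5)) loop (mem[ lit 5 ]≔ mem (lit 5) ⊕ lit 1)

module _ (x : Word) where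

  halve-loop : ∀ c i {μ o} → μ 5 ≡ i → μ 0 ≡ (i + c) + (i + c) →
    Reaches x (whileNonZero mem (lit 0) ⊖ (mem (lit 5) ⊕ mem (lit 5)) loop (mem[ lit 5 ]≔ mem (lit 5) ⊕ lit 1))
      ⟨ μ , o ⟩ (c * 2 + 1)
      (λ s → memory s 5 ≡ i + c × output s ≡ o × (∀ a → a ≢ 5 → memory s a ≡ μ a))
  halve-loop zero i {μ} eq₅ eq₀ =
    _ , _ , while-stop stop , ≤-refl , trans eq₅ (sym (+-identityʳ i)) , refl , λ _ _ → refl
    where
    stop : μ 0 ∸ (μ 5 + μ 5) ≡ 0
    stop = m≤n⇒m∸n≡0 (≤-reflexive (trans eq₀ (sym (cong₂ _+_ eq eq))))
      where
      eq : μ 5 ≡ i + 0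
      eq = trans eq₅ (sym (+-identityʳ i))
  halve-loop (suc c) i {μ} {o} eq₅ eq₀
    with halve-loop c (suc i) {μ [ 5 ↦ μ 5 + 1 ]} {o} (trans (+-comm (μ 5) 1) (cong suc eq₅))
           (trans eq₀ (cong₂ _+_ (+-suc i c) (+-suc i c)))
  ... | s , _ , run , t≤ , half , out , same =
    s , _ , while-step continue assign run , s≤s (s≤s t≤) , trans half (sym (+-suc i c)) , out ,
    λ a a≢5 → trans (same a a≢5) (update-other μ _ a≢5)
    where
    continue : μ 0 ∸ (μ 5 + μ 5) ≢ 0
    continue eq = <⇒≱ (+-mono-< (m<m+n i z<s) (m<m+n i z<s))
      (subst₂ (λ a b → a ≤ b + b) eq₀ eq₅ (m∸n≡0⇒m≤n eq))

^-distrib-* : ∀ o m n → (m * n) ^ o ≡ m ^ o * n ^ o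
^-distrib-* zero    m n = refl
^-distrib-* (suc o) m n = trans (cong (m * n *_) (^-distrib-* o m n)) (interchange m n (m ^ o) (n ^ o))
  where
  interchange : ∀ a b c d → a * b * (c * d) ≡ a * c * (b * d)
  interchange = solve-∀

module _ {s₁ m₁ s₂ m₂} (g : Gen s₁ m₁) (h : Gen s₂ m₂) where

  private
    c₁ e₁ c₂ e₂ : ℕ
    c₁ = coefficient g
    e₁ = degree g
    c₂ = coefficient h
    e₂ = degree h

  opaque

    factor exponentBound : ℕ
    factor        = (6 + c₂) * suc c₁ ^ suc e₂
    exponentBound = suc e₁ * suc e₂

    -- The first stage bounds `N`, so `R`, which dominates `a + P`, also exceeds the loop bound
    -- `N + M` of the second stage. Raising both degrees by one gives `P ≤ R` and `R ≤ R ^ suc e₂`.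
    -- The 6 in `factor` collects 4 units of overhead, `a` and `N + N`.
    total-cost≤ : ∀ N M → N + N ≤ budget M g →
      2 + (budget M g + ((1 + (N * 2 + 1)) + budget (N + M) h)) ≤ factor * suc M ^ exponentBound
    total-cost≤ N M 2N≤a = begin
      2 + (a + ((1 + (N * 2 + 1)) + b))
        ≡⟨ regroup a N b ⟩
      4 + (a + (N + N)) + b
        ≤⟨ +-mono-≤ (+-mono-≤ (*-monoʳ-≤ 4 1≤R^) (+-mono-≤ (≤-trans a≤R R≤R^) (≤-trans (≤-trans 2N≤a a≤R) R≤R^)))
             (≤-trans (budget≤ (N + M) h) (*-monoʳ-≤ c₂
               (≤-trans (^-monoˡ-≤ e₂ N+M<R) (^-monoʳ-≤ R (n≤1+n e₂))))) ⟩
      4 * R ^ suc e₂ + (R ^ suc e₂ + R ^ suc e₂) + c₂ * R ^ suc e₂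
        ≡⟨ collect-terms (R ^ suc e₂) c₂ ⟩
      (6 + c₂) * R ^ suc e₂
        ≡⟨ cong ((6 + c₂) *_) (^-distrib-* (suc e₂) (suc c₁) (P ^ suc e₁)) ⟩
      (6 + c₂) * (suc c₁ ^ suc e₂ * (P ^ suc e₁) ^ suc e₂)
        ≡⟨ *-assoc (6 + c₂) (suc c₁ ^ suc e₂) _ ⟨
      factor * (P ^ suc e₁) ^ suc e₂
        ≡⟨ cong (factor *_) (^-*-assoc P (suc e₁) (suc e₂)) ⟩
      factor * P ^ exponentBound ∎
      where
      open ≤-Reasoning
      a b P R : ℕ
      a = budget M g
      b = budget (N + M) h
      P = suc M
      R = suc c₁ * P ^ suc e₁
      regroup : ∀ a N b → 2 + (a + ((1 + (N * 2 + 1)) + b)) ≡ 4 + (a + (N + N)) + b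
      regroup = solve-∀
      collect-terms : ∀ r c → 4 * r + (r + r) + c * r ≡ (6 + c) * r
      collect-terms = solve-∀
      instance
        R-nonZero : NonZero R
        R-nonZero = m*n≢0 (suc c₁) (P ^ suc e₁) ⦃ _ ⦄ ⦃ m^n≢0 P (suc e₁) ⦄
      1≤R^ : 1 ≤ R ^ suc e₂
      1≤R^ = m^n>0 R (suc e₂)
      R≤R^ : R ≤ R ^ suc e₂
      R≤R^ = m≤m*n R (R ^ e₂) ⦃ m^n≢0 R e₂ ⦄
      a+P≤R : a + P ≤ R
      a+P≤R = ≤-trans (≤-reflexive (+-comm a P)) (+-mono-≤ (m≤m*n P (P ^ e₁) ⦃ m^n≢0 P e₁ ⦄)
        (≤-trans (budget≤ M g) (*-monoʳ-≤ c₁ (^-monoʳ-≤ P (n≤1+n e₁)))))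
      a≤R : a ≤ R
      a≤R = ≤-trans (m≤m+n a P) a+P≤R
      N+M<R : suc (N + M) ≤ R
      N+M<R = ≤-trans (≤-reflexive (sym (+-suc N M))) (≤-trans (+-monoˡ-≤ P (≤-trans (m≤m+n N N) 2N≤a)) a+P≤R)

length≤size : ∀ w → length w ≤ size w
length≤size []      = z≤n
length≤size (m ∷ w) = s≤s (≤-trans (length≤size w) (m≤n+m (size w) ⌊log₂ m ⌋))

length-cartesianProductWith : ∀ {A B C : Set} (f : A → B → C) xs ys →
  length (cartesianProductWith f xs ys) ≡ length xs * length ys
length-cartesianProductWith f []       ys = refl
length-cartesianProductWith f (x ∷ xs) ys = trans (length-++ (map (f x) ys))
  (cong₂ _+_ (length-map (f x) ys) (length-cartesianProductWith f xs ys))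

-- `order` is itself written in binary and may be far larger than its own digit count; it is bounded
-- through the `order * order` matrix entries.
order≤size : ∀ I → CliqueInstance.order I ≤ size (word I)
order≤size I = ≤-trans (n≤n*n order) (≤-trans (≤-reflexive (sym matrix-length))
  (≤-trans (m≤n+m _ 2) (length≤size (word I))))
  where
  open CliqueInstance I
  n≤n*n : ∀ n → n ≤ n * n
  n≤n*n zero    = z≤n
  n≤n*n (suc n) = m≤m*n (suc n) (suc n)
  matrix-length : length (encodeMatrix _~?_) ≡ order * order
  matrix-length = trans (length-cartesianProductWith _ (allFin order) (allFin order))
    (cong₂ _*_ (length-tabulate {n = order} id) (length-tabulate {n = order} id))

-- The complete program and the reduction

module Reduction (e : ℕ) where
  open Stages e

  program : Cmd
  program = (mem[ lit 3 ]≔ input (lit 0) ⨾ mem[ lit 4 ]≔ input (lit 1)) ⨾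
            compile positionGen ⨾ halve ⨾ compile outputGen

  module _ (x : Word) (n k : ℕ) (n≡ : nth x 0 ≡ n) (k≡ : nth x 1 ≡ k) where
    private
      open Vertices e n k (validFor x n) using (M; N; labels)
      open Construction e using (d)
      α : ℕ → ℕ
      α = nth (concatMap (places x n k) labels)

    n≤M : n ≤ M
    n≤M = ≤-trans (m≤n+m n (2 + (d + d))) (m≤m+n _ k)
    k≤M : k ≤ M
    k≤M = m≤n+m k (2 + (d + d) + n)
    d≤M : d ≤ M
    d≤M = ≤-trans (m≤n+m d (2 + d)) (≤-trans (m≤m+n (2 + (d + d)) n) (m≤m+n _ k))
    e≤M : e ≤ M
    e≤M = ≤-trans (m≤n+m e 2) d≤M

    position-cost output-cost : ℕ
    position-cost = budget M positionGen
    output-cost   = budget (N + M) outputGen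

    position-bounded : Bounded x α M (bounds n k) positionGen
    position-bounded = k≤M , λ i → k≤M , λ j →
      (d≤M , λ b → vertex-bounded , vertex-bounded) , (n≤M , λ t → vertex-bounded) ,
      (n≤M , λ t → vertex-bounded) , (n≤M , λ u → n≤M , λ v → n≤M ,
        vertex-bounded , vertex-bounded , vertex-bounded , vertex-bounded , vertex-bounded ,
        (e≤M , λ m → vertex-bounded))
      where
      vertex-bounded = (≤-refl , tt) , (≤-refl , tt)

    runs : Reaches x program initial (2 + (position-cost + ((1 + (N * 2 + 1)) + output-cost)))
             (λ s → output s ≡ ⟦_⟧ x α outputGen (bounds n k [ 2 ↦ N ]))
    runs = setup ⟫′ λ H → compile-reaches x M positionGen position-bounded H ⟫′ λ H′ → halved H′ ⟫′ λ H″ →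
      weaken x ≤-refl (λ { (holds _ (_ , out)) → out }) (compile-reaches x (N + M) outputGen output-bounded H″)
      where
      infixr 4 _⟫′_
      _⟫′_ = _⟫_ x
      after-position = ⟦_⟧ x α positionGen (bounds n k)
      setup : Reaches x (mem[ lit 3 ]≔ input (lit 0) ⨾ mem[ lit 4 ]≔ input (lit 1)) initial 2
                (Holds x array 2 α (bounds n k) [])
      setup = _ , _ , seq assign assign , ≤-refl , holds
        (λ { {zero} _ → n≡ ; {suc zero} _ → k≡ ; {suc (suc _)} (s≤s (s≤s ())) })
        (refl , (λ a → sym (nth-[] a)) , refl)
      halved : ∀ {s} → Holds x array 2 α (bounds n k) after-position s →
               Reaches x halve s (1 + (N * 2 + 1)) (Holds x tape 3 α (bounds n k [ 2 ↦ N ]) [])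
      halved {⟨ μ , o ⟩} (holds vars (len , arr , out))
        with halve-loop x N 0 {μ [ 5 ↦ 0 ]} {o} refl
               (trans len (trans (cong length (positionGen-correct x n k α)) (length-pairs _ _ labels)))
      ... | s , _ , run , t≤ , half , out′ , same = s , _ , seq assign run , s≤s t≤ ,
        bind x (holds
          (λ { {zero} p → trans (same 3 λ ()) (vars p)
             ; {suc zero} p → trans (same 4 λ ()) (vars p)
             ; {suc (suc _)} (s≤s (s≤s ())) })
          ((λ a → trans (same (16 + a) λ ()) (trans (arr a)
              (cong (λ w → nth w a) (positionGen-correct x n k α)))) , trans out′ out)) half
      output-bounded : Bounded x α (N + M) (bounds n k [ 2 ↦ N ]) outputGen
      output-bounded = tt , (≤-trans k≤M (m≤n+m M N) , tt) , (m≤m+n N M , λ _ → m≤m+n N M , λ _ → tt) ,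
        (m≤m+n N M , λ _ → tt , tt , tt , tt , tt , tt)

    two-N≤ : N + N ≤ position-cost
    two-N≤ = ≤-trans
      (≤-reflexive (sym (trans (cong length (positionGen-correct x n k α)) (length-pairs _ _ labels))))
      (length≤budget x {α = α} {ρ = bounds n k} M positionGen position-bounded)

  reduce : CliqueInstance → UnitTwoTrackInstance
  reduce I = record
    { graph      = graph
    ; _~?_       = Vertices._~?_ e order k (valid I)
    ; family     = family
    ; represents = represents
    ; k          = k * k
    }
    where
    open CliqueInstance I using (order; k)
    open Vertices e order k (valid I)

  -- `suc M` is `3 + 2 * d + order + k` and `order` is at most the input size, so `suc M` is at most
  -- `4 + 2 * d + k` times that size; this is where `a` comes from.
  a c E : ℕ
  a = 4 + (Construction.d e + Construction.d e)
  c = factor positionGen outputGen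
  E = exponentBound positionGen outputGen

  Target : ParameterizedProblem
  Target = DistancePerfectCodeOnUnitTwoTrackGraphs (suc (suc e))

  open ParameterizedProblem using (encode; Yes)

  module _ (I : CliqueInstance) where
    open CliqueInstance I using (order; k)
    open Vertices e order k (valid I) using (M; N; code⇔solution)

    correct : Yes Clique I ⇔ Yes Target (reduce I)
    correct = mk⇔
      (Equivalence.to codes ∘ clique⇒solution I e)
      (solution⇒clique I e ∘ Equivalence.from codes)
      where
      codes = code⇔solution (λ {i} {u} {v} → validFor-diagonal (word I) order {i} {u} {v})

    suc-M≤ : suc M ≤ (a + k) * size (word I)
    suc-M≤ = begin
      suc M                    ≡⟨ regroup (Construction.d e + Construction.d e) order k ⟩
      order + b                ≤⟨ +-mono-≤ (order≤size I) (m≤m*n b (size (word I))) ⟩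
      (a + k) * size (word I)  ∎
      where
      open ≤-Reasoning
      b = 3 + (Construction.d e + Construction.d e) + k
      regroup : ∀ d n k → 3 + d + n + k ≡ n + (3 + d + k)
      regroup = solve-∀

    steps≤ : 2 + (budget M positionGen + ((1 + (N * 2 + 1)) + budget (N + M) outputGen)) ≤
             c * (a + k) ^ E * size (word I) ^ E
    steps≤ = begin
      2 + (budget M positionGen + ((1 + (N * 2 + 1)) + budget (N + M) outputGen))
        ≤⟨ total-cost≤ positionGen outputGen N M (two-N≤ (word I) order k refl refl) ⟩
      c * suc M ^ E
        ≤⟨ *-monoʳ-≤ c (^-monoˡ-≤ E suc-M≤) ⟩
      c * ((a + k) * size (word I)) ^ E
        ≡⟨ cong (c *_) (^-distrib-* E (a + k) (size (word I))) ⟩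
      c * ((a + k) ^ E * size (word I) ^ E)
        ≡⟨ *-assoc c ((a + k) ^ E) (size (word I) ^ E) ⟨
      c * (a + k) ^ E * size (word I) ^ E ∎
      where open ≤-Reasoning

    in-time : ∃[ t ] (program maps word I to encode Target (reduce I) in-steps t) ×
              t ≤ c * (a + k) ^ E * size (word I) ^ E
    in-time =
      let s , t , run , t≤ , out = runs (word I) order k refl refl in
      t , (s , run , trans out (outputGen-correct (word I) order k)) , ≤-trans t≤ steps≤

  reduction : FPTReduction Clique Target
  reduction = record
    { reduce          = reduce
    ; correct         = correct
    ; program         = program
    ; g               = λ k → c * (a + k) ^ E
    -- The square of `k` in the shape that `computable-polynomial` delivers.
    ; h               = λ k → 1 * (0 + k) ^ 2
    ; g-computable    = computable-polynomial a c E
    ; h-computable    = computable-polynomial 0 1 2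
    ; exponent        = E
    ; runs-in-time    = in-time
    ; parameter-bound = λ I → let open CliqueInstance I using (k) in
        ≤-reflexive (sym (trans (*-identityˡ _) (cong (k *_) (*-identityʳ k))))
    }

theorem9 : (d : ℕ) → 2 ≤ d → W[1]-Hard (DistancePerfectCodeOnUnitTwoTrackGraphs d)
theorem9 (suc (suc e)) (s≤s (s≤s z≤n)) = Reduction.reduction e
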